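{- Let $n \in \mathbb{N}$ with $n \equiv 1 \pmod 3$ and let $T$ be a tree on $n$ vertices. If there exists a non-leaf vertex $v$ of $T$ such that $T$ rooted at $v$ has an ASP from $v$, then $R(T, \mathbb{Z}_3) \leq n + 1$, with equality if $T$ has no vertex of degree $\equiv 0 \pmod 3$.
   Context: Let $T$ be a tree and $v$ a vertex of $T$. There is an automorphism switchable pendant (ASP) at $v$ if there exists a non-trivial automorphism $\sigma$ of the forest $T - v$ and a vertex $x$ of $T - v$ such that $x$ is a neighbour of $v$ in $T$ but $\sigma(x)$ is not. If $T$ is rooted at $r$, $T$ has an ASP from $r$ if there is an ASP at $r$ or at some vertex of a subtree from $r$ (i.e. of a component of $T - r$). For a graph $G$ on $n$ vertices with $3 \mid e(G)$, $R(G, \mathbb{Z}_3)$ is the smallest positive integer such that for every $N \geq R(G,\mathbb{Z}_3)$ and every edge-colouring $f\colon E(K_N) \to \mathbb{Z}_3$, there is a subgraph of $K_N$ isomorphic to $G$ whose edge colours sum to $0$ in $\mathbb{Z}_3$. -}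

module Defs where

open import Data.Nat using (ℕ; zero; suc; _+_; _≤_; _<ᵇ_; _%_)
open import Data.Bool using (Bool; true; false; if_then_else_; _∧_)
open import Data.Fin using (Fin; toℕ; inject₁; fromℕ) renaming (zero to fzero; suc to fsuc)
open import Data.List using (List; map; allFin)
open import Data.Nat.ListAction using (sum)
open import Data.Unit using (⊤)
open import Data.Product using (Σ; ∃; _×_; _,_)
open import Data.Sum using (_⊎_)
open import Relation.Nullary using (¬_)
open import Relation.Binary.PropositionalEquality using (_≡_; _≢_)
open import Function.Definitions using (Injective)

record Graph (n : ℕ) : Set where
  field
    adj    : Fin n → Fin n → Bool
    sym    : ∀ u w → adj u w ≡ adj w u
    irrefl : ∀ u → adj u u ≡ false
open Graph public

E : ∀ {n} → Graph n → Fin n → Fin n → Set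
E G u w = adj G u w ≡ true

deg : ∀ {n} → Graph n → Fin n → ℕ
deg {n} G v = sum (map (λ w → if adj G v w then 1 else 0) (allFin n))

Leaf : ∀ {n} → Graph n → Fin n → Set
Leaf G v = deg G v ≡ 1

VSet : ℕ → Set₁
VSet n = Fin n → Set

data Reach {n} (G : Graph n) (X : VSet n) : Fin n → Fin n → Set where
  here : ∀ {a} → X a → Reach G X a a
  step : ∀ {a b c} → X a → E G a b → Reach G X b c → Reach G X a c

All : ∀ {n} → VSet n
All _ = ⊤

Connected : ∀ {n} → Graph n → Set
Connected G = ∀ a b → Reach G All a b

HasCycle : ∀ {n} → Graph n → Set
HasCycle {n} G =
  ∃ λ (k : ℕ) → ∃ λ (p : Fin (suc (suc (suc k))) → Fin n) →
    Injective _≡_ _≡_ p ×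
    (∀ (i : Fin (suc (suc k))) → E G (p (inject₁ i)) (p (fsuc i))) ×
    E G (p (fromℕ (suc (suc k)))) (p fzero)

IsTree : ∀ {n} → Graph n → Set
IsTree G = Connected G × ¬ HasCycle G

record Aut {n} (G : Graph n) (X : VSet n) : Set where
  field
    σ      : Fin n → Fin n
    σ⁻¹    : Fin n → Fin n
    invˡ   : ∀ x → σ⁻¹ (σ x) ≡ x
    invʳ   : ∀ x → σ (σ⁻¹ x) ≡ x
    pres   : ∀ x → X x → X (σ x)
    fixOut : ∀ x → ¬ X x → σ x ≡ x
    hom    : ∀ x y → X x → X y → adj G x y ≡ adj G (σ x) (σ y)
open Aut public

NonTrivial : ∀ {n} {G : Graph n} {X : VSet n} → Aut G X → Set
NonTrivial {X = X} a = ∃ λ x → X x × σ a x ≢ x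

_∖_ : ∀ {n} → VSet n → Fin n → VSet n
(Y ∖ v) u = Y u × u ≢ v

-- ASP at v in the tree G[Y] (v ∈ Y): a non-trivial automorphism σ of the
-- forest G[Y] - v and a vertex x of it adjacent to v with σ x not adjacent to v
ASPat : ∀ {n} → Graph n → VSet n → Fin n → Set
ASPat G Y v =
  Σ (Aut G (Y ∖ v)) λ a → NonTrivial a ×
    ∃ λ x → (Y ∖ v) x × E G v x × ¬ E G v (σ a x)

Subtree : ∀ {n} → Graph n → Fin n → Fin n → VSet n
Subtree G r c u = Reach G (All ∖ r) c u

ASPfrom : ∀ {n} → Graph n → Fin n → Set
ASPfrom G r =
  ASPat G All r ⊎
  (∃ λ c → E G r c × ∃ λ u → Subtree G r c u × ASPat G (Subtree G r c) u)

copySum : ∀ {n N} → Graph n → (Fin n → Fin N) → (Fin N → Fin N → Fin 3) → ℕ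
copySum {n} G φ c =
  sum (map (λ u → sum (map (λ w →
        if (toℕ u <ᵇ toℕ w) ∧ adj G u w then toℕ (c (φ u) (φ w)) else 0)
      (allFin n))) (allFin n))

-- every Z_3 edge-colouring of K_N has a zero-sum copy of G
-- (an edge-colouring is a symmetric function on pairs; diagonal ignored)
ZeroSumGood : ∀ {n} → Graph n → ℕ → Set
ZeroSumGood {n} G N =
  (c : Fin N → Fin N → Fin 3) → (∀ i j → c i j ≡ c j i) →
  ∃ λ (φ : Fin n → Fin N) → Injective _≡_ _≡_ φ × copySum G φ c % 3 ≡ 0

RBound : ∀ {n} → Graph n → ℕ → Set
RBound G m = ∀ N → m ≤ N → ZeroSumGood G N

IsR : ∀ {n} → Graph n → ℕ → Set
IsR G m = 1 ≤ m × RBound G m × (∀ k → 1 ≤ k → RBound G k → m ≤ k)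

module Submission where

-- Suppose the colouring f of K on n + 1 vertices has no zero-sum copy of T. The hypothesis on v makes T a non-star, so T
-- has pendant edges p₁ℓ₁, p₂ℓ₂ with p₁ ≠ p₂. Put p₁, p₂ at p, q and move ℓ₁, ℓ₂ among three positions x, y, z (one vertex
-- is always uncovered): the sum is never 0, so on {x, y, z} one of f(p,·), f(q,·), f(p,·) − f(q,·) is constant, or all
-- three colours occur in both rows; a sixth vertex, or a look at the path on 4 vertices, rules out the latter. Hence f is
-- constant off one vertex, or takes one value inside a vertex set C and another elsewhere, or has the form g(u) + g(v).
-- In the first case leave that vertex uncovered. In the last, two disjoint swaps of vertices of different degree mod 3
-- reach every residue; they exist since not all degrees are ≡ 1, as n ≡ 1 (mod 3). For C one needs |C| or |C| − 1 vertices
-- of T spanning ≡ 0 (mod 3) edges: a subtree, or a subtree with a vertex x of degree ≢ 1 removed, grown from x through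
-- all neighbours of x first.

open import Defs hiding (sym)
open import Algebra.Bundles using (CommutativeMonoid)
open import Data.Bool using (Bool; true; false; if_then_else_; _∧_; _∨_; not) renaming (T to IsTrue)
open import Data.Bool.Properties using (not-involutive) renaming (_≟_ to _≟ᵇ_)
open import Data.Empty using (⊥)
open import Data.Fin using (Fin; toℕ; fromℕ; inject₁; inject≤; punchIn; punchOut; finToFun; funToFin) renaming (zero to fzero; suc to fsuc)
open import Data.Fin.Patterns using (0F; 1F; 2F)
open import Data.Fin.Permutation.Components using (transpose; transpose-inverse)
open import Data.Fin.Properties using (_≟_; all?; any?; finToFun-funToFin; inject≤-injective; injective⇒≤; punchInᵢ≢i; punchIn-injective; punchOut-injective; suc-injective; toℕ-injective)
open import Data.List using (allFin; tabulate) renaming (map to mapᴸ)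
open import Data.List.Properties using (map-cong; map-tabulate)
open import Data.Nat using (ℕ; zero; suc; pred; _+_; _^_; _%_; _≤_; _<_; _<ᵇ_; z≤n; s≤s; >-nonZero)
open import Data.Nat.DivMod using ([m+n]%n≡m%n)
open import Data.Nat.ListAction using () renaming (sum to sumᴸ)
open import Data.Product using (∃; _×_; _,_; proj₁; proj₂)
open import Data.Sum using (_⊎_; inj₁; inj₂)
open import Data.Unit using (tt)
open import Data.Vec using (Vec; []; _∷_; lookup)
open import Data.Vec.Functional using (Vector; removeAt)
open import Data.Vec.Relation.Unary.All using ([]; _∷_) renaming (All to Allᵛ)
open import Data.Vec.Relation.Unary.All.Properties using (lookup⁺; lookup⁻)
open import Data.Vec.Relation.Unary.AllPairs using ([]; _∷_)
open import Data.Vec.Relation.Unary.Unique.Propositional using (Unique)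
open import Data.Vec.Relation.Unary.Unique.Propositional.Properties using (lookup-injective)
open import Function using (_∘_; case_of_)
open import Function.Definitions using (Injective)
open import Relation.Binary.Definitions using (tri<; tri≈; tri>)
open import Relation.Binary.PropositionalEquality using (_≡_; _≢_; refl; sym; trans; cong; cong₂; subst; isEquivalence; module ≡-Reasoning)
open import Relation.Nullary using (¬_; Dec; yes; no; does; contradiction)
open import Relation.Nullary.Decidable using (toWitness; map′; _×-dec_; _⊎-dec_; _→-dec_; ¬?; dec-true; dec-false; decidable-stable)
import Algebra.Properties.CommutativeMonoid.Sum as MonoidSum
import Data.Nat.Properties as ℕ

-- Sums over edges with values mod 3

-- The alternative with three colours is a genuine obstacle. With ℓ₁ at i and ℓ₂ at j the total is a
-- constant minus f(p,i) minus f(q,j). If f(q,·) is c - f(p,·) and f(p,·) takes three values on {x,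
-- y, z}, the total varies only by f(p,j) - f(p,i), which is never 0 for i ≠ j, so moving the leaves
-- always misses one residue. A third row excludes this: three rows opposed in pairs make 2f(p,·)
-- constant. On five vertices there is no third row over x, y, z, hence the separate treatment of
-- the path. The residue |C| ≡ 0 is the other obstacle: subtrees on |C| or |C| - 1 vertices have ≡ 2
-- or ≡ 1 edges. Removing a vertex of degree d from a subtree with j edges that contains all its
-- neighbours leaves j vertices and j - d edges; j = |C| serves d ≡ 0 and j = |C| - 1 serves d ≡ 2,
-- which is why a vertex of degree ≢ 1 is wanted.

Z₃ : Set
Z₃ = Fin 3

infixl 6 _⊕_

_⊕_ : Z₃ → Z₃ → Z₃
0F ⊕ b  = b
1F ⊕ 0F = 1F
1F ⊕ 1F = 2F
1F ⊕ 2F = 0F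
2F ⊕ 0F = 2F
2F ⊕ 1F = 0F
2F ⊕ 2F = 1F

infixl 7 _⊗_

_⊗_ : Z₃ → Z₃ → Z₃
0F ⊗ b = 0F
1F ⊗ b = b
2F ⊗ b = b ⊕ b

double : Z₃ → Z₃
double a = a ⊕ a

⊕-assoc : ∀ a b c → (a ⊕ b) ⊕ c ≡ a ⊕ (b ⊕ c)
⊕-assoc = toWitness {a? = all? λ a → all? λ b → all? λ c → (a ⊕ b) ⊕ c ≟ a ⊕ (b ⊕ c)} tt

⊕-comm : ∀ a b → a ⊕ b ≡ b ⊕ a
⊕-comm = toWitness {a? = all? λ a → all? λ b → a ⊕ b ≟ b ⊕ a} tt

⊕-identityʳ : ∀ a → a ⊕ 0F ≡ a
⊕-identityʳ = toWitness {a? = all? λ a → a ⊕ 0F ≟ a} tt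

⊗-comm : ∀ a b → a ⊗ b ≡ b ⊗ a
⊗-comm = toWitness {a? = all? λ a → all? λ b → a ⊗ b ≟ b ⊗ a} tt

⊗-zeroʳ : ∀ a → a ⊗ 0F ≡ 0F
⊗-zeroʳ = toWitness {a? = all? λ a → a ⊗ 0F ≟ 0F} tt

⊗-distribˡ : ∀ a b c → a ⊗ (b ⊕ c) ≡ a ⊗ b ⊕ a ⊗ c
⊗-distribˡ = toWitness {a? = all? λ a → all? λ b → all? λ c → a ⊗ (b ⊕ c) ≟ a ⊗ b ⊕ a ⊗ c} tt

-- 2 is invertible modulo 3, so counting every edge twice loses nothing: a `total` vanishes exactly
-- when the edge sum does.
double-injective : ∀ a b → double a ≡ double b → a ≡ b
double-injective = toWitness {a? = all? λ a → all? λ b → (double a ≟ double b) →-dec (a ≟ b)} tt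

⊕-monoid : CommutativeMonoid _ _
⊕-monoid = record
  { Carrier = Z₃ ; _≈_ = _≡_ ; _∙_ = _⊕_ ; ε = 0F
  ; isCommutativeMonoid = record
    { isMonoid = record
      { isSemigroup = record
        { isMagma = record { isEquivalence = isEquivalence ; ∙-cong = cong₂ _⊕_ }
        ; assoc = ⊕-assoc }
      ; identity = (λ _ → refl) , ⊕-identityʳ }
    ; comm = ⊕-comm } }

open MonoidSum ⊕-monoid using (sum; sum-cong-≗; sum-remove; sum-replicate-zero; ∑-distrib-+; ∑-comm)

sum-zero : ∀ {n} (t : Vector Z₃ n) → (∀ i → t i ≡ 0F) → sum t ≡ 0F
sum-zero {n} t t≡0 = trans (sum-cong-≗ t≡0) (sum-replicate-zero n)

sum-single : ∀ {n} (t : Vector Z₃ n) i → (∀ j → j ≢ i → t j ≡ 0F) → sum t ≡ t i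
sum-single {suc n} t i t≡0 = begin
  sum t                      ≡⟨ sum-remove {i = i} t ⟩
  t i ⊕ sum (removeAt t i)   ≡⟨ cong (t i ⊕_) (sum-zero _ λ j → t≡0 _ (punchInᵢ≢i i j)) ⟩
  t i ⊕ 0F                   ≡⟨ ⊕-identityʳ _ ⟩
  t i                        ∎
  where open ≡-Reasoning

⊗-distribˡ-sum : ∀ {n} a (t : Vector Z₃ n) → a ⊗ sum t ≡ sum (λ i → a ⊗ t i)
⊗-distribˡ-sum {zero}  a t = ⊗-zeroʳ a
⊗-distribˡ-sum {suc n} a t =
  trans (⊗-distribˡ a _ _) (cong (a ⊗ t fzero ⊕_) (⊗-distribˡ-sum a (t ∘ fsuc)))

⟦_⟧ : ℕ → Z₃
⟦ zero ⟧  = 0F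
⟦ suc k ⟧ = 1F ⊕ ⟦ k ⟧

⟦⟧-+ : ∀ j k → ⟦ j + k ⟧ ≡ ⟦ j ⟧ ⊕ ⟦ k ⟧
⟦⟧-+ zero    k = refl
⟦⟧-+ (suc j) k = trans (cong (1F ⊕_) (⟦⟧-+ j k)) (sym (⊕-assoc 1F ⟦ j ⟧ ⟦ k ⟧))

⟦⟧-toℕ : ∀ (a : Z₃) → ⟦ toℕ a ⟧ ≡ a
⟦⟧-toℕ = toWitness {a? = all? λ a → ⟦ toℕ a ⟧ ≟ a} tt

toℕ-⟦⟧ : ∀ k → toℕ ⟦ k ⟧ ≡ k % 3
toℕ-⟦⟧ 0 = refl
toℕ-⟦⟧ 1 = refl
toℕ-⟦⟧ 2 = refl
toℕ-⟦⟧ (suc (suc (suc k))) = begin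
  toℕ (1F ⊕ (1F ⊕ (1F ⊕ ⟦ k ⟧)))  ≡⟨ cong toℕ (three ⟦ k ⟧) ⟩
  toℕ ⟦ k ⟧                       ≡⟨ toℕ-⟦⟧ k ⟩
  k % 3                           ≡⟨ [m+n]%n≡m%n k 3 ⟨
  (k + 3) % 3                     ≡⟨ cong (_% 3) (ℕ.+-comm k 3) ⟩
  (3 + k) % 3                     ∎
  where
  open ≡-Reasoning
  three : ∀ a → 1F ⊕ (1F ⊕ (1F ⊕ a)) ≡ a
  three = toWitness {a? = all? λ a → 1F ⊕ (1F ⊕ (1F ⊕ a)) ≟ a} tt

⟦⟧≡ : ∀ k (a : Z₃) → k % 3 ≡ toℕ a → ⟦ k ⟧ ≡ a
⟦⟧≡ k a eq = toℕ-injective (trans (toℕ-⟦⟧ k) eq)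

%3≡ : ∀ k (a : Z₃) → ⟦ k ⟧ ≡ a → k % 3 ≡ toℕ a
%3≡ k a eq = trans (sym (toℕ-⟦⟧ k)) (cong toℕ eq)

⟦⟧-sum : ∀ {n} (t : Fin n → ℕ) → ⟦ sumᴸ (mapᴸ t (allFin n)) ⟧ ≡ sum (⟦_⟧ ∘ t)
⟦⟧-sum t = trans (cong (⟦_⟧ ∘ sumᴸ) (map-tabulate (λ i → i) t)) (go t)
  where
  go : ∀ {n} (t : Fin n → ℕ) → ⟦ sumᴸ (tabulate t) ⟧ ≡ sum (⟦_⟧ ∘ t)
  go {zero}  t = refl
  go {suc n} t = trans (⟦⟧-+ (t fzero) _) (cong (⟦ t fzero ⟧ ⊕_) (go (t ∘ fsuc)))

infixr 8 _▹_

_▹_ : Bool → Z₃ → Z₃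
b ▹ a = if b then a else 0F

⟦⟧-if : ∀ b k → ⟦ if b then k else 0 ⟧ ≡ b ▹ ⟦ k ⟧
⟦⟧-if true  k = refl
⟦⟧-if false k = refl

_==_ : ∀ {n} → Fin n → Fin n → Bool
u == w = does (u ≟ w)

==-refl : ∀ {n} (u : Fin n) → (u == u) ≡ true
==-refl u = dec-true (u ≟ u) refl

==-≢ : ∀ {n} {u w : Fin n} → u ≢ w → (u == w) ≡ false
==-≢ {u = u} {w} = dec-false (u ≟ w)

module EdgeSums {n : ℕ} (T : Graph n) where

  Weight : Set
  Weight = Fin n → Fin n → Z₃

  Symmetric : Weight → Set
  Symmetric F = ∀ u w → F u w ≡ F w u

  row : Weight → Fin n → Z₃
  row F u = sum λ w → adj T u w ▹ F u w

  -- Every edge is counted in both directions.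
  total : Weight → Z₃
  total F = sum (row F)

  total-cong : ∀ {F G} → (∀ u w → u ≢ w → F u w ≡ G u w) → total F ≡ total G
  total-cong {F} {G} F≡G = sum-cong-≗ λ u → sum-cong-≗ λ w → pt u w
    where
    pt : ∀ u w → adj T u w ▹ F u w ≡ adj T u w ▹ G u w
    pt u w with u ≟ w
    ... | yes refl rewrite irrefl T u = refl
    ... | no u≢w = cong (adj T u w ▹_) (F≡G u w u≢w)

  total-zero : ∀ F → (∀ u w → u ≢ w → F u w ≡ 0F) → total F ≡ 0F
  total-zero F F≡0 = trans (total-cong F≡0) (sum-zero {n} _ λ u → sum-zero {n} _ λ w → pt (adj T u w))
    where
    pt : ∀ b → b ▹ 0F ≡ 0F
    pt true  = refl
    pt false = refl

  total-⊕ : ∀ F G → total (λ u w → F u w ⊕ G u w) ≡ total F ⊕ total G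
  total-⊕ F G = trans (sum-cong-≗ λ u →
      trans (sum-cong-≗ λ w → pt (adj T u w) (F u w) (G u w)) (∑-distrib-+ {n} _ _))
    (∑-distrib-+ (row F) (row G))
    where
    pt : ∀ b x y → b ▹ (x ⊕ y) ≡ b ▹ x ⊕ b ▹ y
    pt true  x y = refl
    pt false x y = refl

  total-⊗ : ∀ a F → total (λ u w → a ⊗ F u w) ≡ a ⊗ total F
  total-⊗ a F = sym (trans (⊗-distribˡ-sum {n} a _) (sum-cong-≗ λ u →
      trans (⊗-distribˡ-sum {n} a _) (sum-cong-≗ λ w → pt (adj T u w) (F u w))))
    where
    pt : ∀ b x → a ⊗ (b ▹ x) ≡ b ▹ (a ⊗ x)
    pt true  x = refl
    pt false x = ⊗-zeroʳ a

  total-transpose : ∀ F → total (λ u w → F w u) ≡ total F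
  total-transpose F = trans (∑-comm {n} {n} _)
    (sum-cong-≗ λ w → sum-cong-≗ λ u → cong (_▹ F w u) (Graph.sym T u w))

  -- `copySum` meets each edge once, from its smaller endpoint. The edges read from the larger
  -- endpoint form the transposed weight, and symmetry of `c` makes both halves equal.
  total-copySum : ∀ {N} (φ : Fin n → Fin N) (c : Fin N → Fin N → Z₃) → (∀ i j → c i j ≡ c j i) →
                  total (λ u w → c (φ u) (φ w)) ≡ double ⟦ copySum T φ c ⟧
  total-copySum φ c c-sym = begin
    total F
      ≡⟨ sum-cong-≗ (λ u → sum-cong-≗ λ w → split u w) ⟩
    total (λ u w → lt u w ▹ F u w ⊕ lt w u ▹ F u w)
      ≡⟨ total-⊕ (λ u w → lt u w ▹ F u w) (λ u w → lt w u ▹ F u w) ⟩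
    total half ⊕ total (λ u w → lt w u ▹ F u w)
      ≡⟨ cong (total half ⊕_) (total-cong λ u w _ → cong (lt w u ▹_) (c-sym (φ u) (φ w))) ⟩
    total half ⊕ total (λ u w → half w u)
      ≡⟨ cong (total half ⊕_) (total-transpose half) ⟩
    double (total half)
      ≡⟨ cong double half≡ ⟨
    double ⟦ copySum T φ c ⟧ ∎
    where
    open ≡-Reasoning
    F half : Weight
    F u w = c (φ u) (φ w)
    lt : Fin n → Fin n → Bool
    lt u w = toℕ u <ᵇ toℕ w
    half u w = lt u w ▹ F u w
    lt-true : ∀ {i j} → i < j → (i <ᵇ j) ≡ true
    lt-true {i} {j} p with i <ᵇ j | ℕ.<⇒<ᵇ p
    ... | true | _ = refl
    lt-false : ∀ {i j} → ¬ (i < j) → (i <ᵇ j) ≡ false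
    lt-false {i} {j} ¬p with i <ᵇ j in eq
    ... | false = refl
    ... | true  = contradiction (ℕ.<ᵇ⇒< i j (subst IsTrue (sym eq) tt)) ¬p
    split : ∀ u w → adj T u w ▹ F u w ≡ adj T u w ▹ (lt u w ▹ F u w ⊕ lt w u ▹ F u w)
    split u w with ℕ.<-cmp (toℕ u) (toℕ w)
    ... | tri< u<w _ w≮u rewrite lt-true u<w | lt-false w≮u = cong (adj T u w ▹_) (sym (⊕-identityʳ _))
    ... | tri> u≮w _ w<u rewrite lt-true w<u | lt-false u≮w = refl
    ... | tri≈ _ u≡w _ rewrite toℕ-injective u≡w | irrefl T w = refl
    entry : ∀ l a (x : Z₃) → ⟦ if l ∧ a then toℕ x else 0 ⟧ ≡ a ▹ (l ▹ x)
    entry true  true  x = ⟦⟧-toℕ x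
    entry true  false x = refl
    entry false true  x = refl
    entry false false x = refl
    half≡ : ⟦ copySum T φ c ⟧ ≡ total half
    half≡ = trans (⟦⟧-sum {n} _) (sum-cong-≗ λ u →
      trans (⟦⟧-sum {n} _) (sum-cong-≗ λ w → entry (lt u w) (adj T u w) (F u w)))

  degree : Fin n → Z₃
  degree u = ⟦ deg T u ⟧

  degree-row : ∀ u → degree u ≡ row (λ _ _ → 1F) u
  degree-row u = trans (⟦⟧-sum {n} _) (sum-cong-≗ λ w → ⟦⟧-if (adj T u w) 1)

  -- Handshake identity: each edge at `u` contributes `h u` once, so of `T` only the degrees modulo
  -- 3 enter.
  total-additive : ∀ (h : Fin n → Z₃) → total (λ u w → h u ⊕ h w) ≡ double (sum λ u → degree u ⊗ h u)
  total-additive h = begin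
    total (λ u w → h u ⊕ h w)                          ≡⟨ total-⊕ (λ u _ → h u) (λ _ w → h w) ⟩
    total (λ u _ → h u) ⊕ total (λ _ w → h w)          ≡⟨ cong (total (λ u _ → h u) ⊕_) (total-transpose (λ u _ → h u)) ⟩
    double (total (λ u _ → h u))                       ≡⟨ cong double (sum-cong-≗ rowh) ⟩
    double (sum λ u → degree u ⊗ h u)                  ∎
    where
    open ≡-Reasoning
    pt : ∀ x b → b ▹ x ≡ x ⊗ (b ▹ 1F)
    pt x true  = toWitness {a? = all? λ x → x ≟ x ⊗ 1F} tt x
    pt x false = sym (⊗-zeroʳ x)
    rowh : ∀ u → row (λ u _ → h u) u ≡ degree u ⊗ h u
    rowh u = begin
      row (λ u _ → h u) u          ≡⟨ sum-cong-≗ (λ w → pt (h u) (adj T u w)) ⟩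
      sum (λ w → h u ⊗ (adj T u w ▹ 1F)) ≡⟨ ⊗-distribˡ-sum {n} (h u) _ ⟨
      h u ⊗ row (λ _ _ → 1F) u     ≡⟨ cong (h u ⊗_) (degree-row u) ⟨
      h u ⊗ degree u               ≡⟨ ⊗-comm (h u) (degree u) ⟩
      degree u ⊗ h u               ∎

  cut : Fin n → Weight → Weight
  cut v F u w = if (u == v) ∨ (w == v) then 0F else F u w

  cut-cong : ∀ {F G} v u w → (u ≢ v → w ≢ v → F u w ≡ G u w) → cut v F u w ≡ cut v G u w
  cut-cong v u w F≡G with u ≟ v | w ≟ v
  ... | yes _  | _      = refl
  ... | no _   | yes _  = refl
  ... | no u≢v | no w≢v = F≡G u≢v w≢v

  cut-off : ∀ {u v w} F → u ≢ v → w ≢ v → cut v F u w ≡ F u w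
  cut-off F u≢v w≢v rewrite ==-≢ u≢v | ==-≢ w≢v = refl

  cut-symmetric : ∀ v {F} → Symmetric F → Symmetric (cut v F)
  cut-symmetric v F-sym u w with u == v | w == v
  ... | true  | true  = refl
  ... | true  | false = refl
  ... | false | true  = refl
  ... | false | false = F-sym u w

  -- The edges at `v` are seen from both ends, hence the factor 2. At a leaf the row collapses to
  -- one value by `row-single`.
  total-cut : ∀ v {F} → Symmetric F → total F ≡ total (cut v F) ⊕ double (row F v)
  total-cut v {F} F-sym = begin
    total F
      ≡⟨ sum-cong-≗ (λ u → sum-cong-≗ λ w → split u w) ⟩
    total (λ u w → cut v F u w ⊕ (near u w ⊕ near w u))
      ≡⟨ total-⊕ (cut v F) (λ u w → near u w ⊕ near w u) ⟩
    total (cut v F) ⊕ total (λ u w → near u w ⊕ near w u)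
      ≡⟨ cong (total (cut v F) ⊕_) (total-⊕ near (λ u w → near w u)) ⟩
    total (cut v F) ⊕ (total near ⊕ total (λ u w → near w u))
      ≡⟨ cong (λ z → total (cut v F) ⊕ (total near ⊕ z)) (total-transpose near) ⟩
    total (cut v F) ⊕ double (total near)
      ≡⟨ cong (λ z → total (cut v F) ⊕ double z) near≡ ⟩
    total (cut v F) ⊕ double (row F v) ∎
    where
    open ≡-Reasoning
    near : Weight
    near u w = (u == v) ▹ F u w
    split : ∀ u w → adj T u w ▹ F u w ≡ adj T u w ▹ (cut v F u w ⊕ (near u w ⊕ near w u))
    split u w with u ≟ v | w ≟ v
    ... | yes refl | yes refl rewrite irrefl T u = refl
    ... | yes refl | no _  = cong (adj T u w ▹_) (sym (⊕-identityʳ (F u w)))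
    ... | no _  | yes refl = cong (adj T u w ▹_) (F-sym u w)
    ... | no _  | no _  = cong (adj T u w ▹_) (sym (⊕-identityʳ (F u w)))
    near≡ : total near ≡ row F v
    near≡ = trans (sum-single (row near) v λ u u≢v → sum-zero _ λ w → off u w u≢v) (sum-cong-≗ on)
      where
      off : ∀ u w → u ≢ v → adj T u w ▹ near u w ≡ 0F
      off u w u≢v rewrite ==-≢ u≢v with adj T u w
      ... | true  = refl
      ... | false = refl
      on : ∀ w → adj T v w ▹ near v w ≡ adj T v w ▹ F v w
      on w rewrite ==-refl v = refl

  row-single : ∀ F {v p} → E T v p → (∀ w → E T v w → w ≢ p → F v w ≡ 0F) → row F v ≡ F v p
  row-single F {v} {p} vp only = trans (sum-single _ p off) (cong (_▹ F v p) vp)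
    where
    off : ∀ w → w ≢ p → adj T v w ▹ F v w ≡ 0F
    off w w≢p with adj T v w in eq
    ... | true  = only w eq w≢p
    ... | false = refl

-- Growing subtrees

bool-cases : ∀ b → b ≡ true ⊎ b ≡ false
bool-cases true  = inj₁ refl
bool-cases false = inj₂ refl

true≢false : ∀ {b} → b ≡ true → b ≢ false
true≢false refl ()

bit : Bool → ℕ
bit b = if b then 1 else 0

-- Finite vertex sets and their sizes

card : ∀ {n} → (Fin n → Bool) → ℕ
card {zero}  W = 0
card {suc n} W = bit (W fzero) + card (W ∘ fsuc)

card-cong : ∀ {n} {V W : Fin n → Bool} → (∀ u → V u ≡ W u) → card V ≡ card W
card-cong {zero}  V≡W = refl
card-cong {suc n} V≡W = cong₂ _+_ (cong bit (V≡W fzero)) (card-cong (V≡W ∘ fsuc))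

card-remove : ∀ {n} (W : Fin (suc n) → Bool) i → card W ≡ bit (W i) + card (W ∘ punchIn i)
card-remove W fzero = refl
card-remove {suc n} W (fsuc i) = begin
  bit (W fzero) + card (W ∘ fsuc)
    ≡⟨ cong (bit (W fzero) +_) (card-remove (W ∘ fsuc) i) ⟩
  bit (W fzero) + (bit (W (fsuc i)) + rest)
    ≡⟨ ℕ.+-assoc (bit (W fzero)) _ _ ⟨
  bit (W fzero) + bit (W (fsuc i)) + rest
    ≡⟨ cong (_+ rest) (ℕ.+-comm (bit (W fzero)) _) ⟩
  bit (W (fsuc i)) + bit (W fzero) + rest
    ≡⟨ ℕ.+-assoc (bit (W (fsuc i))) _ _ ⟩
  bit (W (fsuc i)) + (bit (W fzero) + rest) ∎
  where
  open ≡-Reasoning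
  rest = card (λ u → W (fsuc (punchIn i u)))

card-∁ : ∀ {n} (W : Fin n → Bool) → card W + card (not ∘ W) ≡ n
card-∁ {zero}  W = refl
card-∁ {suc n} W with W fzero
... | true  = cong suc (card-∁ (W ∘ fsuc))
... | false = trans (ℕ.+-suc _ _) (cong suc (card-∁ (W ∘ fsuc)))

card≤ : ∀ {n} (W : Fin n → Bool) → card W ≤ n
card≤ W = subst (card W ≤_) (card-∁ W) (ℕ.m≤m+n _ _)

card-replicate-false : ∀ n → card {n} (λ _ → false) ≡ 0
card-replicate-false zero    = refl
card-replicate-false (suc n) = card-replicate-false n

card-false : ∀ {n} (W : Fin n → Bool) → (∀ u → W u ≡ false) → card W ≡ 0
card-false {n} W all = trans (card-cong all) (card-replicate-false n)

card-witness : ∀ {n} (W : Fin n → Bool) → 0 < card W → ∃ λ u → W u ≡ true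
card-witness W pos with any? (λ u → W u ≟ᵇ true)
... | yes w = w
... | no none = contradiction (card-false W λ u → off u (bool-cases (W u))) (ℕ.>⇒≢ pos)
  where
  off : ∀ u → W u ≡ true ⊎ W u ≡ false → W u ≡ false
  off u (inj₁ t) = contradiction (u , t) none
  off u (inj₂ f) = f

⟦card⟧ : ∀ {n} (W : Fin n → Bool) → ⟦ card W ⟧ ≡ sum (λ u → W u ▹ 1F)
⟦card⟧ {zero}  W = refl
⟦card⟧ {suc n} W =
  trans (⟦⟧-+ (bit (W fzero)) _) (cong₂ _⊕_ (⟦⟧-if (W fzero) 1) (⟦card⟧ (W ∘ fsuc)))

insert : ∀ {n} → Fin n → (Fin n → Bool) → Fin n → Bool
insert y W u = (u == y) ∨ W u

insert-here : ∀ {n} (y : Fin n) W → insert y W y ≡ true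
insert-here y W rewrite ==-refl y = refl

insert-there : ∀ {n} {y u : Fin n} W → u ≢ y → insert y W u ≡ W u
insert-there W u≢y rewrite ==-≢ u≢y = refl

insert-⊇ : ∀ {n} (y : Fin n) W {u} → W u ≡ true → insert y W u ≡ true
insert-⊇ y W {u} Wu with u == y
... | true  = refl
... | false = Wu

insert-∈ : ∀ {n} {y u : Fin n} W → insert y W u ≡ true → u ≡ y ⊎ W u ≡ true
insert-∈ {y = y} {u} W eq with u ≟ y
... | yes u≡y = inj₁ u≡y
... | no _    = inj₂ eq

delete : ∀ {n} → Fin n → (Fin n → Bool) → Fin n → Bool
delete y W u = not (u == y) ∧ W u

delete-here : ∀ {n} (y : Fin n) W → delete y W y ≡ false
delete-here y W rewrite ==-refl y = refl

delete-there : ∀ {n} {y u : Fin n} W → u ≢ y → delete y W u ≡ W u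
delete-there W u≢y rewrite ==-≢ u≢y = refl

card-flip : ∀ {n} {V W : Fin n → Bool} y → W y ≡ false → V y ≡ true →
            (∀ u → u ≢ y → V u ≡ W u) → card V ≡ suc (card W)
card-flip {suc n} {V} {W} y Wy Vy V≡W = begin
  card V                            ≡⟨ card-remove V y ⟩
  bit (V y) + card (V ∘ punchIn y)  ≡⟨ cong₂ _+_ (cong bit Vy) (card-cong λ i → V≡W _ (punchInᵢ≢i y i)) ⟩
  suc (card (W ∘ punchIn y))        ≡⟨ cong (λ b → suc (bit b + card (W ∘ punchIn y))) Wy ⟨
  suc (bit (W y) + card (W ∘ punchIn y)) ≡⟨ cong suc (card-remove W y) ⟨
  suc (card W) ∎
  where open ≡-Reasoning

card-insert : ∀ {n} {W : Fin n → Bool} y → W y ≡ false → card (insert y W) ≡ suc (card W)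
card-insert {W = W} y Wy = card-flip y Wy (insert-here y W) λ u → insert-there W

card-full : ∀ {n} (W : Fin n → Bool) → card W ≡ n → ∀ u → W u ≡ true
card-full {n} W full u with W u in eq
... | true  = refl
... | false = contradiction (subst (_≤ n) (trans (card-insert {W = W} u eq) (cong suc full)) (card≤ (insert u W))) (ℕ.<-irrefl refl)

card-missing : ∀ {n} (W : Fin n → Bool) → card W < n → ∃ λ u → W u ≡ false
card-missing {n} W lt with card-witness (not ∘ W) (ℕ.n≢0⇒n>0 λ z →
    ℕ.<⇒≢ lt (trans (sym (trans (cong (card W +_) z) (ℕ.+-identityʳ _))) (card-∁ W)))
... | u , eq = u , go (W u) eq
  where
  go : ∀ b → not b ≡ true → b ≡ false
  go false _ = refl

E-sym : ∀ {n} (T : Graph n) {u w} → E T u w → E T w u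
E-sym T {u} {w} e = trans (Graph.sym T w u) e

E-irrefl : ∀ {n} (T : Graph n) {u w} → E T u w → u ≢ w
E-irrefl T {u} e refl = true≢false e (irrefl T u)

-- Walks, simple paths and acyclicity

module _ {n : ℕ} {T : Graph n} where

  Reach-source : ∀ {X : VSet n} {a c} → Reach T X a c → X a
  Reach-source (here Xa)     = Xa
  Reach-source (step Xa _ _) = Xa

  Reach-target : ∀ {X : VSet n} {a c} → Reach T X a c → X c
  Reach-target (here Xa)    = Xa
  Reach-target (step _ _ r) = Reach-target r

  Reach-trans : ∀ {X : VSet n} {a b c} → Reach T X a b → Reach T X b c → Reach T X a c
  Reach-trans (here _)      s = s
  Reach-trans (step Xa e r) s = step Xa e (Reach-trans r s)

  Reach-sym : ∀ {X : VSet n} {a c} → Reach T X a c → Reach T X c a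
  Reach-sym (here Xa)     = here Xa
  Reach-sym (step Xa e r) = Reach-trans (Reach-sym r) (step (Reach-source r) (E-sym T e) (here Xa))

  Reach-mono : ∀ {X Y : VSet n} → (∀ {u} → X u → Y u) → ∀ {a c} → Reach T X a c → Reach T Y a c
  Reach-mono X⊆Y (here Xa)     = here (X⊆Y Xa)
  Reach-mono X⊆Y (step Xa e r) = step (X⊆Y Xa) e (Reach-mono X⊆Y r)

  exit-edge : ∀ (W : Fin n → Bool) {a c} → Reach T All a c → W a ≡ true → W c ≡ false →
              ∃ λ p → ∃ λ y → W p ≡ true × W y ≡ false × E T p y
  exit-edge W (here _) Wa Wc = contradiction Wc (true≢false Wa)
  exit-edge W (step {a} {b} _ e r) Wa Wc with W b in eq
  ... | true  = exit-edge W r eq Wc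
  ... | false = a , b , Wa , eq , e

  record IsPath (X : VSet n) {k} (p : Fin (suc k) → Fin n) : Set where
    field
      injective : Injective _≡_ _≡_ p
      edges     : ∀ i → E T (p (inject₁ i)) (p (fsuc i))
      inside    : ∀ i → X (p i)

  open IsPath

  IsPath-tail : ∀ {X : VSet n} {k} {p : Fin (suc (suc k)) → Fin n} → IsPath X p → IsPath X (p ∘ fsuc)
  IsPath-tail P = record
    { injective = suc-injective ∘ injective P
    ; edges     = edges P ∘ fsuc
    ; inside    = inside P ∘ fsuc }

  SimplePath : VSet n → Fin n → Fin n → Set
  SimplePath X a c = ∃ λ k → ∃ λ (p : Fin (suc k) → Fin n) → IsPath X p × p fzero ≡ a × p (fromℕ k) ≡ c

  suffix : ∀ {X : VSet n} {k} {p : Fin (suc k) → Fin n} → IsPath X p → ∀ i → SimplePath X (p i) (p (fromℕ k))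
  suffix P fzero = _ , _ , P , refl , refl
  suffix {k = suc k} P (fsuc i) = suffix (IsPath-tail P) i

  simplePath : ∀ {X : VSet n} {a c} → Reach T X a c → SimplePath X a c
  simplePath {a = a} (here Xa) = 0 , (λ _ → a) , record
    { injective = λ { {fzero} {fzero} _ → refl } ; edges = λ () ; inside = λ _ → Xa } , refl , refl
  simplePath {X} {a} {c} (step Xa e r) with simplePath r
  ... | k , p , P , refl , refl with any? (λ i → p i ≟ a)
  -- The new starting vertex already lies on the path: drop the loop and keep the rest.
  ...   | yes (i , refl) = suffix P i
  ...   | no a∉p = suc k , q , record { injective = inj ; edges = edg ; inside = ins } , refl , refl
    where
    q : Fin (suc (suc k)) → Fin n
    q fzero    = a
    q (fsuc i) = p i
    inj : Injective _≡_ _≡_ q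
    inj {fzero}  {fzero}  _  = refl
    inj {fzero}  {fsuc j} eq = contradiction (j , sym eq) a∉p
    inj {fsuc i} {fzero}  eq = contradiction (i , eq) a∉p
    inj {fsuc i} {fsuc j} eq = cong fsuc (injective P eq)
    edg : ∀ i → E T (q (inject₁ i)) (q (fsuc i))
    edg fzero    = e
    edg (fsuc i) = edges P i
    ins : ∀ i → X (q i)
    ins fzero    = Xa
    ins (fsuc i) = inside P i

  -- Two neighbours of b joined by a path avoiding b would close a cycle.
  neighbour-unique : ¬ HasCycle T → ∀ {X : VSet n} {a a′ b} → ¬ X b → E T b a → E T b a′ →
                     Reach T X a a′ → a ≡ a′
  neighbour-unique acyclic {X} {a} {a′} {b} b∉X ba ba′ r with simplePath r
  ... | zero  , p , P , refl , refl = refl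
  ... | suc k , p , P , refl , refl = contradiction (k , q , (λ {i} {j} → inj {i} {j}) , edg , E-sym T ba′) acyclic
    where
    q : Fin (suc (suc (suc k))) → Fin n
    q fzero    = b
    q (fsuc i) = p i
    inj : Injective _≡_ _≡_ q
    inj {fzero}  {fzero}  _    = refl
    inj {fzero}  {fsuc j} refl = contradiction (inside P j) b∉X
    inj {fsuc i} {fzero}  refl = contradiction (inside P i) b∉X
    inj {fsuc i} {fsuc j} eq   = cong fsuc (injective P eq)
    edg : ∀ i → E T (q (inject₁ i)) (q (fsuc i))
    edg fzero    = ba
    edg (fsuc i) = edges P i

-- Subtrees grown from a root

module Trees {n : ℕ} (T : Graph n) (connected : Connected T) (acyclic : ¬ HasCycle T) where

  open EdgeSums T

  no-triangle : ∀ {u v w} → E T v u → E T v w → ¬ E T u w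
  no-triangle {u} {v} {w} vu vw uw = E-irrefl T uw
    (neighbour-unique {T = T} acyclic {X = _≢ v} (λ v≢v → v≢v refl) vu vw
      (step (E-irrefl T vu ∘ sym) uw (here (E-irrefl T vw ∘ sym))))

  within : (Fin n → Bool) → Weight
  within W u w = W u ▹ W w ▹ 1F

  within-symmetric : ∀ W → Symmetric (within W)
  within-symmetric W u w with W u | W w
  ... | true  | true  = refl
  ... | true  | false = refl
  ... | false | true  = refl
  ... | false | false = refl

  cut-within : ∀ y {V W} → W y ≡ false → (∀ u → u ≢ y → V u ≡ W u) → ∀ u w → cut y (within V) u w ≡ within W u w
  cut-within y {V} {W} Wy V≡W u w with u ≟ y | w ≟ y
  ... | yes refl | _        rewrite Wy = refl
  ... | no u≢y   | no w≢y   rewrite V≡W u u≢y | V≡W w w≢y = refl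
  ... | no u≢y   | yes refl rewrite Wy with W u
  ...   | true  = refl
  ...   | false = refl

  -- phase: all neighbours of x are taken before any other vertex.
  record Grown (x : Fin n) (j : ℕ) : Set where
    field
      W       : Fin n → Bool
      root    : W x ≡ true
      reach   : ∀ a → W a ≡ true → Reach T (λ u → W u ≡ true) x a
      size    : card W ≡ suc j
      edges   : total (within W) ≡ double ⟦ j ⟧
      phase   : (∀ a → W a ≡ true → a ≡ x ⊎ E T x a) ⊎ (∀ a → E T x a → W a ≡ true)

  open Grown

  record Frontier {x j} (G : Grown x j) : Set where
    field
      y p    : Fin n
      y∉     : W G y ≡ false
      p∈     : W G p ≡ true
      edge   : E T y p
      unique : ∀ w → E T y w → W G w ≡ true → w ≡ p
      phase′ : (E T x y × (∀ a → W G a ≡ true → a ≡ x ⊎ E T x a)) ⊎ (∀ a → E T x a → W G a ≡ true)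

  frontier-unique : ∀ {x j} (G : Grown x j) {y p} → W G y ≡ false → W G p ≡ true → E T y p →
                    ∀ w → E T y w → W G w ≡ true → w ≡ p
  frontier-unique G y∉ p∈ yp w yw w∈ = neighbour-unique {T = T} acyclic (λ y∈ → true≢false y∈ y∉) yw yp
    (Reach-trans (Reach-sym (reach G w w∈)) (reach G _ p∈))

  -- Missing neighbours of `x` take precedence. An arbitrary exit edge is used only when none is
  -- missing, and this is what makes `phase′` hold.
  frontier : ∀ {x j} (G : Grown x j) → suc j < n → Frontier G
  frontier {x} {j} G j<n with any? (λ y → (adj T x y ≟ᵇ true) ×-dec (W G y ≟ᵇ false))
  ... | yes (y , xy , y∉) = record
    { y = y ; p = x ; y∉ = y∉ ; p∈ = root G ; edge = E-sym T xy
    ; unique = frontier-unique G y∉ (root G) (E-sym T xy)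
    ; phase′ = inj₁ (xy , first (phase G)) }
    where
    first : _ → ∀ a → W G a ≡ true → a ≡ x ⊎ E T x a
    first (inj₁ ph) = ph
    first (inj₂ ph) = contradiction y∉ (true≢false (ph y xy))
  ... | no none with card-missing (W G) (subst (_< n) (sym (size G)) j<n)
  ...   | z , z∉ with exit-edge (W G) (connected x z) (root G) z∉
  ...     | p , y , p∈ , y∉ , py = record
    { y = y ; p = p ; y∉ = y∉ ; p∈ = p∈ ; edge = E-sym T py
    ; unique = frontier-unique G y∉ p∈ (E-sym T py)
    ; phase′ = inj₂ λ a xa → covered a xa (bool-cases (W G a)) }
    where
    covered : ∀ a → E T x a → W G a ≡ true ⊎ W G a ≡ false → W G a ≡ true
    covered a xa (inj₁ a∈) = a∈
    covered a xa (inj₂ a∉) = contradiction (a , xa , a∉) none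

  -- Inside the enlarged set `y` is a leaf, so cutting at `y` removes exactly one edge, counted in
  -- both directions.
  extend : ∀ {x j} (G : Grown x j) → Frontier G → Grown x (suc j)
  extend {x} {j} G F = record
    { W = W′ ; root = ⊇ (root G) ; reach = reach′
    ; size = trans (card-insert y y∉) (cong suc (size G))
    ; edges = edges′ ; phase = ph phase′ }
    where
    open Frontier F
    open ≡-Reasoning
    W′ = insert y (W G)
    ⊇ : ∀ {u} → W G u ≡ true → W′ u ≡ true
    ⊇ = insert-⊇ y (W G)
    reach′ : ∀ a → W′ a ≡ true → Reach T (λ u → W′ u ≡ true) x a
    reach′ a a∈ with insert-∈ (W G) a∈
    ... | inj₁ refl = Reach-trans (Reach-mono ⊇ (reach G p p∈))
                        (step (⊇ p∈) (E-sym T edge) (here (insert-here y (W G))))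
    ... | inj₂ a∈W  = Reach-mono ⊇ (reach G a a∈W)
    only : ∀ w → E T y w → w ≢ p → within W′ y w ≡ 0F
    only w yw w≢p rewrite insert-here y (W G) with W′ w in eq
    ... | false = refl
    ... | true with insert-∈ {y = y} (W G) eq
    ...   | inj₁ refl = contradiction refl (E-irrefl T yw)
    ...   | inj₂ w∈   = contradiction (unique w yw w∈) w≢p
    yp≡1 : within W′ y p ≡ 1F
    yp≡1 rewrite insert-here y (W G) | ⊇ p∈ = refl
    count : ∀ a → double a ⊕ double 1F ≡ double (1F ⊕ a)
    count = toWitness {a? = all? λ a → double a ⊕ double 1F ≟ double (1F ⊕ a)} tt
    edges′ : total (within W′) ≡ double ⟦ suc j ⟧
    edges′ = begin
      total (within W′)
        ≡⟨ total-cut y (within-symmetric W′) ⟩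
      total (cut y (within W′)) ⊕ double (row (within W′) y)
        ≡⟨ cong₂ _⊕_ (total-cong λ u w _ → cut-within y y∉ (λ u → insert-there (W G)) u w)
                     (cong double (trans (row-single (within W′) edge only) yp≡1)) ⟩
      total (within (W G)) ⊕ double 1F
        ≡⟨ cong (_⊕ double 1F) (edges G) ⟩
      double ⟦ j ⟧ ⊕ double 1F
        ≡⟨ count ⟦ j ⟧ ⟩
      double ⟦ suc j ⟧ ∎
    ph : (E T x y × (∀ a → W G a ≡ true → a ≡ x ⊎ E T x a)) ⊎ (∀ a → E T x a → W G a ≡ true) →
         (∀ a → W′ a ≡ true → a ≡ x ⊎ E T x a) ⊎ (∀ a → E T x a → W′ a ≡ true)
    ph (inj₂ all) = inj₂ λ a xa → ⊇ (all a xa)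
    ph (inj₁ (xy , near)) = inj₁ λ a a∈ → case insert-∈ (W G) a∈ of λ where
      (inj₁ refl) → inj₂ xy
      (inj₂ a∈W)  → near a a∈W

  grow : ∀ x j → suc j ≤ n → Grown x j
  grow x (suc j) j<n = let G = grow x j (ℕ.<⇒≤ j<n) in extend G (frontier G j<n)
  grow x zero _ = record
    { W = _== x ; root = ==-refl x
    ; reach = λ a a∈ → subst (Reach T _ x) (sym (is-x a a∈)) (here (==-refl x))
    ; size = trans (card-flip {V = _== x} {W = λ _ → false} x refl (==-refl x) (λ u u≢x → ==-≢ u≢x)) (cong suc (card-replicate-false n))
    ; edges = total-zero _ off
    ; phase = inj₁ λ a a∈ → inj₁ (is-x a a∈) }
    where
    is-x : ∀ a → (a == x) ≡ true → a ≡ x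
    is-x a eq with a ≟ x
    ... | yes a≡x = a≡x
    off : ∀ u w → u ≢ w → within (_== x) u w ≡ 0F
    off u w u≢w with u ≟ x
    ... | no _ = refl
    ... | yes refl rewrite ==-≢ (u≢w ∘ sym) = refl

  -- The edge count of a tree, read off a subtree grown from `x` until it fills `T`.
  total-one : Fin n → ∀ {j} → n ≡ suc j → total (λ _ _ → 1F) ≡ double ⟦ j ⟧
  total-one x {j} refl = trans (total-cong λ u w _ → sym (full u w)) (edges G)
    where
    G = grow x j ℕ.≤-refl
    full : ∀ u w → within (W G) u w ≡ 1F
    full u w rewrite card-full (W G) (size G) u | card-full (W G) (size G) w = refl

  record PendantEdge (ℓ p : Fin n) : Set where
    field
      edge : E T ℓ p
      only : ∀ w → E T ℓ w → w ≡ p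

  -- The leaf is the last vertex reached from x.
  far-leaf : ∀ x {j} → n ≡ suc (suc j) → ∃ λ ℓ → ∃ λ p → PendantEdge ℓ p × ℓ ≢ x ×
             (∀ z → z ≢ x → ¬ E T x z → ¬ E T x ℓ)
  far-leaf x {j} refl = y , p , record { edge = edge ; only = λ w yw → unique w yw (others w (E-irrefl T yw ∘ sym)) }
      , (λ y≡x → true≢false (root G) (subst (λ u → W G u ≡ false) y≡x y∉)) , far phase′
    where
    G = grow x j (ℕ.n≤1+n (suc j))
    F = frontier G ℕ.≤-refl
    open Frontier F
    others : ∀ w → w ≢ y → W G w ≡ true
    others w w≢y = trans (sym (insert-there (W G) w≢y))
      (card-full (insert y (W G)) (trans (card-insert {W = W G} y y∉) (cong suc (size G))) w)
    far : _ → ∀ z → z ≢ x → ¬ E T x z → ¬ E T x y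
    far (inj₂ all) z z≢x z≁x xy = true≢false (all y xy) y∉
    far (inj₁ (_ , near)) z z≢x z≁x xy with near z (others z λ z≡y → z≁x (subst (E T x) (sym z≡y) xy))
    ... | inj₁ z≡x = z≢x z≡x
    ... | inj₂ xz  = z≁x xz

  -- The two phases are the two alternatives. If only neighbours of `x` were taken, all `j` edges
  -- meet `x` and none survives its removal. If all neighbours are present, exactly `deg T x` edges
  -- disappear. In between, the number of lost edges would be out of control.
  punctured : ∀ x j → suc j ≤ n → ∃ λ V → card V ≡ j ×
              (total (within V) ≡ 0F ⊎ total (within V) ⊕ double (degree x) ≡ double ⟦ j ⟧)
  punctured x j j<n = V , size-V , result (phase G)
    where
    open ≡-Reasoning
    G = grow x j j<n
    V = delete x (W G)
    V≡W : ∀ u → u ≢ x → W G u ≡ V u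
    V≡W u u≢x = sym (delete-there (W G) u≢x)
    size-V : card V ≡ j
    size-V = ℕ.suc-injective (trans (sym (card-flip x (delete-here x (W G)) (root G) V≡W)) (size G))
    split : total (within V) ⊕ double (row (within (W G)) x) ≡ double ⟦ j ⟧
    split = begin
      total (within V) ⊕ double (row (within (W G)) x)
        ≡⟨ cong (_⊕ double (row (within (W G)) x)) (total-cong λ u w _ → cut-within x (delete-here x (W G)) V≡W u w) ⟨
      total (cut x (within (W G))) ⊕ double (row (within (W G)) x)
        ≡⟨ total-cut x (within-symmetric (W G)) ⟨
      total (within (W G))
        ≡⟨ edges G ⟩
      double ⟦ j ⟧ ∎
    cancel : ∀ a b → a ⊕ b ≡ b → a ≡ 0F
    cancel = toWitness {a? = all? λ a → all? λ b → (a ⊕ b ≟ b) →-dec (a ≟ 0F)} tt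
    result : (∀ a → W G a ≡ true → a ≡ x ⊎ E T x a) ⊎ (∀ a → E T x a → W G a ≡ true) →
             total (within V) ≡ 0F ⊎ total (within V) ⊕ double (degree x) ≡ double ⟦ j ⟧
    result (inj₂ all) = inj₂ (subst (λ r → total (within V) ⊕ double r ≡ double ⟦ j ⟧) row≡ split)
      where
      pt : ∀ w → adj T x w ▹ within (W G) x w ≡ adj T x w ▹ 1F
      pt w rewrite root G with adj T x w in eq
      ... | false = refl
      ... | true rewrite all w eq = refl
      row≡ : row (within (W G)) x ≡ degree x
      row≡ = trans (sum-cong-≗ pt) (sym (degree-row x))
    result (inj₁ near) = inj₁ (cancel _ (double ⟦ j ⟧) (subst (λ r → total (within V) ⊕ double r ≡ double ⟦ j ⟧) row≡ split))
      where
      pt : ∀ w → adj T x w ▹ within (W G) x w ≡ V w ▹ 1F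
      pt w with w ≟ x
      ... | yes refl rewrite irrefl T w = refl
      ... | no w≢x rewrite root G with W G w in eq
      ...   | true with near w eq
      ...     | inj₁ w≡x = contradiction w≡x w≢x
      ...     | inj₂ xw rewrite xw = refl
      pt w | no w≢x | false with adj T x w
      ...   | true  = refl
      ...   | false = refl
      row≡ : row (within (W G)) x ≡ ⟦ j ⟧
      row≡ = trans (sum-cong-≗ pt) (trans (sym (⟦card⟧ V)) (cong ⟦_⟧ size-V))

-- Colourings satisfying the local condition

infixl 6 _⊖_

-- Subtraction, because doubling is negation modulo 3.
_⊖_ : Z₃ → Z₃ → Z₃
a ⊖ b = a ⊕ double b

⊖-self : ∀ a → a ⊖ a ≡ 0F
⊖-self = toWitness {a? = all? λ a → a ⊖ a ≟ 0F} tt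

⊖-cancelʳ : ∀ b a c → a ⊖ b ≡ c ⊖ b → a ≡ c
⊖-cancelʳ = toWitness {a? = all? λ b → all? λ a → all? λ c → (a ⊖ b ≟ c ⊖ b) →-dec (a ≟ c)} tt

⊖-cancelˡ : ∀ a b c → a ⊖ b ≡ a ⊖ c → b ≡ c
⊖-cancelˡ = toWitness {a? = all? λ a → all? λ b → all? λ c → (a ⊖ b ≟ a ⊖ c) →-dec (b ≟ c)} tt

⊖≡0 : ∀ a b → a ⊖ b ≡ 0F → a ≡ b
⊖≡0 = toWitness {a? = all? λ a → all? λ b → (a ⊖ b ≟ 0F) →-dec (a ≟ b)} tt

Flat : Z₃ → Z₃ → Z₃ → Set
Flat a b c = a ≡ b × b ≡ c

fresh : ∀ {k m} (xs : Vec (Fin m) k) → k < m → ∃ λ e → Allᵛ (e ≢_) xs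
fresh {k} {m} xs k<m with any? (λ e → ¬? (any? λ i → lookup xs i ≟ e))
... | yes (e , e∉) = e , lookup⁻ (λ i e≡ → e∉ (i , sym e≡))
... | no covered = contradiction (injective⇒≤ {f = index} index-injective) (ℕ.<⇒≱ k<m)
  where
  position : ∀ e → ∃ λ i → lookup xs i ≡ e
  position e = decidable-stable (any? λ i → lookup xs i ≟ e) (λ e∉ → covered (e , e∉))
  index : Fin m → Fin k
  index e = proj₁ (position e)
  index-injective : Injective _≡_ _≡_ index
  index-injective {e} {e′} eq =
    trans (sym (proj₂ (position e))) (trans (cong (lookup xs) eq) (proj₂ (position e′)))

Colouring : ℕ → Set
Colouring m = Fin m → Fin m → Z₃

data Shape {m} (f : Colouring m) : Set where
  star     : ∀ s b → (∀ u v → u ≢ v → u ≢ s → v ≢ s → f u v ≡ b) → Shape f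
  clique   : ∀ (C : Fin m → Bool) a b → (∀ u v → u ≢ v → f u v ≡ (if C u ∧ C v then a else b)) → Shape f
  additive : ∀ (g : Fin m → Z₃) → (∀ u v → u ≢ v → f u v ≡ g u ⊕ g v) → Shape f

Local : ∀ {m} → Colouring m → Set
Local {m} f = ∀ {p q x y z : Fin m} → Unique (p ∷ q ∷ x ∷ y ∷ z ∷ []) →
  Flat (f p x) (f p y) (f p z) ⊎ Flat (f q x) (f q y) (f q z) ⊎
  Flat (f p x ⊖ f q x) (f p y ⊖ f q y) (f p z ⊖ f q z)

module Structure {m : ℕ} (5≤m : 5 ≤ m) (f : Colouring m) (f-sym : ∀ u v → f u v ≡ f v u) (local : Local f) where

  unique₅ : ∀ {p q x y z : Fin m} → p ≢ q → p ≢ x → p ≢ y → p ≢ z → q ≢ x → q ≢ y → q ≢ z →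
            x ≢ y → x ≢ z → y ≢ z → Unique (p ∷ q ∷ x ∷ y ∷ z ∷ [])
  unique₅ pq px py pz qx qy qz xy xz yz =
    (pq ∷ px ∷ py ∷ pz ∷ []) ∷ (qx ∷ qy ∷ qz ∷ []) ∷ (xy ∷ xz ∷ []) ∷ (yz ∷ []) ∷ [] ∷ []

  module OddApex {p q x y : Fin m} {b : Z₃} (pq : p ≢ q) (px : p ≢ x) (py : p ≢ y) (qx : q ≢ x) (qy : q ≢ y) (xy : x ≢ y)
    (flat : ∀ z → z ≢ p → z ≢ q → f q z ≡ b) (qp≢b : f q p ≢ b) (x≁y : f p x ≢ f p y) where

    -- Compare rows `r` and `q` on `p`, `z`, `z′`. Row `q` is not flat there because of `p`, but it
    -- is level on `z`, `z′`, so either remaining alternative makes row `r` level on `z`, `z′`.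
    row-flat : ∀ {r z z′} → p ≢ r → q ≢ r → p ≢ z → q ≢ z → p ≢ z′ → q ≢ z′ → r ≢ z → r ≢ z′ → f r z ≡ f r z′
    row-flat {r} {z} {z′} pr qr pz qz pz′ qz′ rz rz′ with z ≟ z′
    ... | yes refl = refl
    ... | no zz′ with local (unique₅ (qr ∘ sym) (pr ∘ sym) rz rz′ (pq ∘ sym) qz qz′ pz pz′ zz′)
    ...   | inj₁ (_ , eq)        = eq
    ...   | inj₂ (inj₁ (eq , _)) = contradiction (trans eq (flat z (pz ∘ sym) (qz ∘ sym))) qp≢b
    ...   | inj₂ (inj₂ (_ , eq)) = ⊖-cancelʳ b _ _ (trans (cong (f r z ⊖_) (sym (flat z (pz ∘ sym) (qz ∘ sym))))
                                     (trans eq (cong (f r z′ ⊖_) (flat z′ (pz′ ∘ sym) (qz′ ∘ sym)))))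

    -- Compare rows `x` and `y` on `p`, `q` and a fifth vertex. Parallel rows would agree at `p`, as
    -- they do at `q`, against `x≁y`. So one of them is flat, and its value `b` at `q` spreads by
    -- `row-flat`.
    xy≡b : f x y ≡ b
    xy≡b with fresh (p ∷ q ∷ x ∷ y ∷ []) 5≤m
    ... | z , (zp ∷ zq ∷ zx ∷ zy ∷ []) with local (unique₅ xy (px ∘ sym) (qx ∘ sym) (zx ∘ sym) (py ∘ sym) (qy ∘ sym) (zy ∘ sym) pq (zp ∘ sym) (zq ∘ sym))
    ...   | inj₁ (_ , eq) = trans (row-flat px qx py qy (zp ∘ sym) (zq ∘ sym) xy (zx ∘ sym))
              (trans (sym eq) (trans (f-sym x q) (flat x (px ∘ sym) (qx ∘ sym))))
    ...   | inj₂ (inj₁ (_ , eq)) = trans (f-sym x y) (trans (row-flat py qy px qx (zp ∘ sym) (zq ∘ sym) (xy ∘ sym) (zy ∘ sym))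
              (trans (sym eq) (trans (f-sym y q) (flat y (py ∘ sym) (qy ∘ sym)))))
    ...   | inj₂ (inj₂ (eq , _)) = contradiction (trans (f-sym p x) (trans (⊖≡0 _ _ (trans eq
              (trans (cong₂ _⊖_ (trans (f-sym x q) (flat x (px ∘ sym) (qx ∘ sym))) (trans (f-sym y q) (flat y (py ∘ sym) (qy ∘ sym)))) (⊖-self b)))) (f-sym y p))) x≁y

    x≡b : ∀ {r} → p ≢ r → q ≢ r → x ≢ r → f x r ≡ b
    x≡b pr qr xr = trans (row-flat px qx pr qr py qy xr xy) xy≡b

    off≡b : ∀ {r z} → p ≢ r → q ≢ r → p ≢ z → q ≢ z → r ≢ z → f r z ≡ b
    off≡b {r} {z} pr qr pz qz rz with r ≟ x
    ... | yes refl = x≡b pz qz rz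
    ... | no rx = trans (row-flat pr qr pz qz px qx rz rx) (trans (f-sym r x) (x≡b pr qr (rx ∘ sym)))

    shape : Shape f
    shape = star p b λ u v uv up vp → go u v uv up vp (q ≟ u) (q ≟ v)
      where
      go : ∀ u v → u ≢ v → u ≢ p → v ≢ p → Dec (q ≡ u) → Dec (q ≡ v) → f u v ≡ b
      go u v uv up vp (yes refl) _ = flat v vp (uv ∘ sym)
      go u v uv up vp (no _) (yes refl) = trans (f-sym u v) (flat u up uv)
      go u v uv up vp (no qu) (no qv) = off≡b (up ∘ sym) qu (vp ∘ sym) qv uv

  module FlatVertex {q : Fin m} {b : Z₃} (flat : ∀ z → z ≢ q → f q z ≡ b) where

    -- The graph of the edges whose colour deviates from `b`; `q` is isolated in it. The shape of
    -- `f` is read off this graph.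
    N : Fin m → Fin m → Set
    N u v = u ≢ v × f u v ≢ b

    N? : ∀ u v → Dec (N u v)
    N? u v = ¬? (u ≟ v) ×-dec ¬? (f u v ≟ b)

    N-sym : ∀ {u v} → N u v → N v u
    N-sym {u} {v} (uv , h) = uv ∘ sym , λ eq → h (trans (f-sym u v) eq)

    N-≢q : ∀ {u v} → N u v → q ≢ u
    N-≢q (uv , h) refl = h (flat _ (uv ∘ sym))

    ¬N : ∀ {u v} → u ≢ v → ¬ N u v → f u v ≡ b
    ¬N {u} {v} uv h = decidable-stable (f u v ≟ b) λ ne → h (uv , ne)

    -- The vertex `q` serves as a reference position: both rows take the value `b` there and deviate
    -- from it elsewhere, so neither is flat, and parallel rows that agree at `q` agree throughout.
    twins : ∀ {r r′ u w} → N r u → q ≢ r′ → q ≢ w → r ≢ r′ → r ≢ w → r′ ≢ u → r′ ≢ w → u ≢ w →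
            f r′ u ≢ b ⊎ f r′ w ≢ b → f r u ≡ f r′ u × f r w ≡ f r′ w
    twins {r} {r′} {u} {w} ru@(r≢u , ru≢b) qr′ qw rr′ rw r′u r′w uw ne
      with local (unique₅ rr′ (N-≢q ru ∘ sym) r≢u rw (qr′ ∘ sym) r′u r′w (N-≢q (N-sym ru)) qw uw)
    ... | inj₁ (eq , _) = contradiction (trans (sym eq) rq≡b) ru≢b
      where rq≡b = trans (f-sym r q) (flat r (N-≢q ru ∘ sym))
    ... | inj₂ (inj₁ (eq , eq′)) = contradiction ne λ where
          (inj₁ ne) → ne (trans (sym eq) r′q≡b)
          (inj₂ ne) → ne (trans (sym eq′) (trans (sym eq) r′q≡b))
      where r′q≡b = trans (f-sym r′ q) (flat r′ (qr′ ∘ sym))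
    ... | inj₂ (inj₂ (eq , eq′)) = ⊖≡0 _ _ (trans (sym eq) level) , ⊖≡0 _ _ (trans (sym eq′) (trans (sym eq) level))
      where
      level : f r q ⊖ f r′ q ≡ 0F
      level = trans (cong₂ _⊖_ (trans (f-sym r q) (flat r (N-≢q ru ∘ sym)))
                              (trans (f-sym r′ q) (flat r′ (qr′ ∘ sym)))) (⊖-self b)

    -- Two vertices with deviating edges copy each other's edges, colours included. All that follows
    -- about `N` consists of applications of this.
    rule : ∀ {r r′ u v} → N r u → N r′ v → r ≢ r′ → u ≢ r′ → v ≢ r → f r u ≡ f r′ u × f r v ≡ f r′ v
    rule {r} {r′} {u} {v} ru r′v rr′ ur′ vr with u ≟ v
    ... | no uv = twins ru (N-≢q r′v) (N-≢q (N-sym r′v)) rr′ (vr ∘ sym) (ur′ ∘ sym) (proj₁ r′v) uv (inj₂ (proj₂ r′v))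
    -- With a common endpoint `twins` still wants a third position besides `q` and `u`; a fifth
    -- vertex supplies it.
    ... | yes refl with fresh (q ∷ r ∷ r′ ∷ u ∷ []) 5≤m
    ...   | e , (eq ∷ er ∷ er′ ∷ eu ∷ []) =
      let ru≡r′u = proj₁ (twins ru (N-≢q r′v) (eq ∘ sym) rr′ (er ∘ sym) (ur′ ∘ sym) (er′ ∘ sym) (eu ∘ sym) (inj₁ (proj₂ r′v)))
      in ru≡r′u , ru≡r′u

    Triangle : Set
    Triangle = ∃ λ a → ∃ λ c → ∃ λ d → N a c × N a d × N c d

    N-transport : ∀ {r r′ u} → r′ ≢ u → N r u → f r u ≡ f r′ u → N r′ u
    N-transport r′u (_ , ne) eq = r′u , λ eq′ → ne (trans eq eq′)

    -- `rule` copies the edge `uv` to `p` and the edge `px` to `v`, which closes the triangle on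
    -- `p`, `x`, `v`.
    disjoint : ∀ {p x u v} → N p x → N u v → p ≢ u → x ≢ u → v ≢ p → x ≢ v → Triangle
    disjoint {p} {x} {u} {v} px uv pu xu vp xv = p , x , v , px , pv , N-sym vx
      where
      pv : N p v
      pv = N-transport (vp ∘ sym) uv (sym (proj₂ (rule px uv pu xu vp)))
      vx : N v x
      vx = N-transport (xv ∘ sym) px (proj₁ (rule px (N-sym uv) (vp ∘ sym) xv (pu ∘ sym)))

    off-edge : ∀ s → Dec (∃ λ u → ∃ λ v → u ≢ s × v ≢ s × N u v)
    off-edge s = any? λ u → any? λ v → ¬? (u ≟ s) ×-dec ¬? (v ≟ s) ×-dec N? u v

    no-off-edge : ∀ s → ¬ (∃ λ u → ∃ λ v → u ≢ s × v ≢ s × N u v) → Shape f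
    no-off-edge s none = star s b λ u v uv us vs → ¬N uv λ h → none (u , v , us , vs , h)

    through : ∀ {p x u v} → N p x → u ≢ p → v ≢ p → N u v → Triangle ⊎ ∃ λ w → w ≢ p × N x w
    through {p} {x} {u} {v} px up vp uv with x ≟ u | x ≟ v
    ... | yes refl | _        = inj₂ (v , vp , uv)
    ... | no _     | yes refl = inj₂ (u , up , N-sym uv)
    ... | no xu    | no xv    = inj₁ (disjoint px uv (up ∘ sym) xu vp xv)

    -- If all deviating edges pass through `p`, or all through `x`, the shape is a star. Otherwise
    -- some edge avoids `p` and some edge avoids `x`. Each is disjoint from `px` or issues from its
    -- other end, and two edges of the latter kind give a triangle by `rule`.
    triangle : ∀ {p x} → N p x → Triangle ⊎ Shape f
    triangle {p} {x} px with off-edge p | off-edge x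
    ... | no none | _       = inj₂ (no-off-edge p none)
    ... | yes _   | no none = inj₂ (no-off-edge x none)
    ... | yes (u , v , up , vp , uv) | yes (u′ , v′ , u′x , v′x , uv′)
      with through px up vp uv | through (N-sym px) u′x v′x uv′
    ...   | inj₁ t | _ = inj₁ t
    ...   | inj₂ _ | inj₁ t = inj₁ t
    ...   | inj₂ (w , wp , xw) | inj₂ (w′ , w′x , pw′) =
      inj₁ (p , x , w′ , px , pw′ , N-transport (w′x ∘ sym) pw′ (proj₁ (rule pw′ xw (proj₁ px) w′x wp)))

    module FromTriangle {a c d} (ac : N a c) (ad : N a d) (cd : N c d) where

      t : Z₃
      t = f a c

      colour : ∀ {z} → N a z → f a z ≡ t
      colour {z} az with z ≟ c
      ... | yes refl = refl
      ... | no zc = trans (f-sym a z) (trans (proj₁ (rule (N-sym az) (N-sym ac) zc (proj₁ ac) (proj₁ az))) (f-sym c a))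

      -- Here the triangle is used: through `rule` its edge `cd` provides every neighbour of `a`
      -- with a neighbour other than `a`, so that `inside` can compare the two rows.
      second : ∀ {z} → N a z → ∃ λ y → y ≢ a × N z y
      second {z} az with z ≟ d | z ≟ c
      ... | yes refl | _        = c , proj₁ ac ∘ sym , N-sym cd
      ... | no _     | yes refl = d , proj₁ ad ∘ sym , cd
      ... | no zd    | no zc    = d , proj₁ ad ∘ sym ,
        N-transport zd cd (proj₁ (rule cd (N-sym az) (zc ∘ sym) (zd ∘ sym) (proj₁ ac)))

      inside : ∀ {z z′} → z ≢ z′ → N a z → N a z′ → f z z′ ≡ t
      inside {z} {z′} zz′ az az′ with second az′
      ... | y , ya , z′y = trans (f-sym z z′)
              (trans (sym (proj₁ (rule az z′y (proj₁ az′) zz′ ya))) (colour az))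

      other : ∀ z → ∃ λ y → y ≢ z × N a y
      other z with c ≟ z
      ... | no cz    = c , cz , ac
      ... | yes refl = d , proj₁ cd ∘ sym , ad

      boundary : ∀ {z z′} → z ≢ z′ → z′ ≢ a → N a z → ¬ N a z′ → f z z′ ≡ b
      boundary {z} {z′} zz′ z′a az az′ = ¬N zz′ λ N-zz′ → case other z of λ where
        (y , yz , ay) → az′ (N-transport (z′a ∘ sym) N-zz′ (sym (proj₂ (rule ay N-zz′ (proj₁ az) yz z′a))))

      outside : ∀ {z z′} → z ≢ z′ → z ≢ a → z′ ≢ a → ¬ N a z → ¬ N a z′ → f z z′ ≡ b
      outside {z} {z′} zz′ za z′a az az′ = ¬N zz′ λ N-zz′ → az′ (N-transport (z′a ∘ sym) N-zz′
        (sym (proj₂ (rule ac N-zz′ (za ∘ sym) (λ { refl → az ac }) z′a))))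

      C : Fin m → Bool
      C z = (z == a) ∨ does (N? a z)

      shape : Shape f
      shape = clique C t b λ u v uv → go uv (u ≟ a) (v ≟ a) (N? a u) (N? a v)
        where
        C-apex : C a ≡ true
        C-apex rewrite ==-refl a = refl
        C-in : ∀ {z} → z ≢ a → N a z → C z ≡ true
        C-in {z} za az rewrite ==-≢ za = dec-true (N? a z) az
        C-out : ∀ {z} → z ≢ a → ¬ N a z → C z ≡ false
        C-out {z} za az rewrite ==-≢ za = dec-false (N? a z) az
        pick : ∀ {u v bu bv} → C u ≡ bu → C v ≡ bv → f u v ≡ (if bu ∧ bv then t else b) →
               f u v ≡ (if C u ∧ C v then t else b)
        pick refl refl eq = eq
        go : ∀ {u v} → u ≢ v → Dec (u ≡ a) → Dec (v ≡ a) → Dec (N a u) → Dec (N a v) →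
             f u v ≡ (if C u ∧ C v then t else b)
        go uv (yes refl) (yes refl) _ _ = contradiction refl uv
        go uv (yes refl) (no va) _ (yes av) = pick C-apex (C-in va av) (colour av)
        go uv (yes refl) (no va) _ (no av)  = pick C-apex (C-out va av) (¬N uv av)
        go {u} {v} uv (no ua) (yes refl) (yes au) _ = pick (C-in ua au) C-apex (trans (f-sym u v) (colour au))
        go {u} {v} uv (no ua) (yes refl) (no au) _  = pick (C-out ua au) C-apex (trans (f-sym u v) (¬N (uv ∘ sym) au))
        go uv (no ua) (no va) (yes au) (yes av) = pick (C-in ua au) (C-in va av) (inside uv au av)
        go uv (no ua) (no va) (yes au) (no av)  = pick (C-in ua au) (C-out va av) (boundary uv va au av)
        go {u} {v} uv (no ua) (no va) (no au) (yes av) =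
          pick (C-out ua au) (C-in va av) (trans (f-sym u v) (boundary (uv ∘ sym) ua av au))
        go uv (no ua) (no va) (no au) (no av)   = pick (C-out ua au) (C-out va av) (outside uv ua va au av)

    shape : Shape f
    shape with any? (λ p → any? (N? p))
    ... | no none = star q b λ u v uv _ _ → ¬N uv λ h → none (u , v , h)
    ... | yes (p , x , px) with triangle px
    ...   | inj₂ s = s
    ...   | inj₁ (a , c , d , ac , ad , cd) = FromTriangle.shape ac ad cd

  -- The pair `x`, `y` rules out two alternatives for every further position, so row `p` is constant
  -- away from `q`. The colour of `pq` then decides between `OddApex`, with the roles exchanged, and
  -- `FlatVertex`.
  half-flat : ∀ {p q x y} → p ≢ q → p ≢ x → p ≢ y → q ≢ x → q ≢ y → x ≢ y → f p x ≡ f p y → f q x ≢ f q y → Shape f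
  half-flat {p} {q} {x} {y} pq px py qx qy xy eq ne = go (f p q ≟ f p x)
    where
    flat : ∀ z → z ≢ p → z ≢ q → f p z ≡ f p x
    flat z zp zq with z ≟ x | z ≟ y
    ... | yes refl | _ = refl
    ... | no _ | yes refl = sym eq
    ... | no zx | no zy with local (unique₅ pq px py (zp ∘ sym) qx qy (zq ∘ sym) xy (zx ∘ sym) (zy ∘ sym))
    ...   | inj₁ (_ , eq′) = sym (trans eq eq′)
    ...   | inj₂ (inj₁ (h , _)) = contradiction h ne
    ...   | inj₂ (inj₂ (h , _)) = contradiction (⊖-cancelˡ (f p y) _ _ (subst (λ c → c ⊖ f q x ≡ f p y ⊖ f q y) eq h)) ne
    all : f p q ≡ f p x → ∀ z → z ≢ p → f p z ≡ f p x
    all h z zp with z ≟ q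
    ... | yes refl = h
    ... | no zq    = flat z zp zq
    go : Dec (f p q ≡ f p x) → Shape f
    go (no h)  = OddApex.shape (pq ∘ sym) qx qy px py xy (λ z zq zp → flat z zp zq) h ne
    go (yes h) = FlatVertex.shape (all h)

  -- A 4-cycle `p x q y` with nonzero alternating sum, the obstruction to an additive colouring.
  Crossed : Fin m → Fin m → Fin m → Fin m → Set
  Crossed p q x y = p ≢ x × p ≢ y × q ≢ x × q ≢ y × f p x ⊖ f q x ≢ f p y ⊖ f q y

  crossed? : ∀ p q x y → Dec (Crossed p q x y)
  crossed? p q x y = ¬? (p ≟ x) ×-dec ¬? (p ≟ y) ×-dec ¬? (q ≟ x) ×-dec ¬? (q ≟ y) ×-dec
                     ¬? (f p x ⊖ f q x ≟ f p y ⊖ f q y)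

  -- If row `p` separates `x` from `y`, a fifth position forces row `q` to be level on them; so
  -- `half-flat` applies with `p` and `q` in one order or the other.
  crossed-shape : ∀ {p q x y} → Crossed p q x y → Shape f
  crossed-shape {p} {q} {x} {y} (px , py , qx , qy , ne) = go (f p x ≟ f p y)
    where
    pq : p ≢ q
    pq refl = ne (trans (⊖-self (f p x)) (sym (⊖-self (f p y))))
    xy : x ≢ y
    xy refl = ne refl
    go : Dec (f p x ≡ f p y) → Shape f
    go (yes eq) = half-flat pq px py qx qy xy eq λ eq′ → ne (cong₂ _⊖_ eq eq′)
    go (no h) with fresh (p ∷ q ∷ x ∷ y ∷ []) 5≤m
    ... | z , (zp ∷ zq ∷ zx ∷ zy ∷ []) with local (unique₅ pq px py (zp ∘ sym) qx qy (zq ∘ sym) xy (zx ∘ sym) (zy ∘ sym))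
    ...   | inj₁ (eq , _)        = contradiction eq h
    ...   | inj₂ (inj₁ (eq , _)) = half-flat (pq ∘ sym) qx qy px py xy eq h
    ...   | inj₂ (inj₂ (eq , _)) = contradiction eq ne

  module Parallel (parallel : ∀ {p q x y} → p ≢ x → p ≢ y → q ≢ x → q ≢ y → f p x ⊖ f q x ≡ f p y ⊖ f q y) where

    module _ {o a c : Fin m} (ao : a ≢ o) (co : c ≢ o) (ca : c ≢ a) where

      -- What is left of `f` after subtracting the row of the base vertex `o`; it proves constant
      -- off `o`.
      K : Fin m → Fin m → Z₃
      K x y = f x y ⊖ f o x ⊖ f o y

      K-sym : ∀ x y → K x y ≡ K y x
      K-sym x y = trans (cong (λ w → w ⊖ f o x ⊖ f o y) (f-sym x y)) (swap (f y x) (f o x) (f o y))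
        where
        swap : ∀ a b c → a ⊖ b ⊖ c ≡ a ⊖ c ⊖ b
        swap = toWitness {a? = all? λ a → all? λ b → all? λ c → a ⊖ b ⊖ c ≟ a ⊖ c ⊖ b} tt

      K-step : ∀ x y z → x ≢ o → y ≢ o → z ≢ o → x ≢ z → y ≢ z → K x z ≡ K y z
      K-step x y z xo yo zo xz yz = cong (_⊖ f o z) (shift (f o x) (f z x) (f o y) (f z y) (f x z) (f y z)
          (f-sym x z) (f-sym y z) (parallel (xo ∘ sym) (yo ∘ sym) (xz ∘ sym) (yz ∘ sym)))
        where
        neg : ∀ a b a′ b′ → a ⊖ b ≡ a′ ⊖ b′ → b ⊖ a ≡ b′ ⊖ a′
        neg = toWitness {a? = all? λ a → all? λ b → all? λ a′ → all? λ b′ →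
                (a ⊖ b ≟ a′ ⊖ b′) →-dec (b ⊖ a ≟ b′ ⊖ a′)} tt
        shift : ∀ a b a′ b′ d d′ → d ≡ b → d′ ≡ b′ → a ⊖ b ≡ a′ ⊖ b′ → d ⊖ a ≡ d′ ⊖ a′
        shift a b a′ b′ _ _ refl refl = neg a b a′ b′

      κ : Z₃
      κ = K c a

      K≡κ : ∀ x y → x ≢ o → y ≢ o → x ≢ y → K x y ≡ κ
      K≡κ x y xo yo xy with y ≟ a
      ... | yes refl = K-step x c y xo co yo xy ca
      ... | no ya = trans (K-step x a y xo ao yo xy (ya ∘ sym)) (trans (K-sym a y) (K-step y c a yo co ao ya ca))

      -- Once `g o` is chosen, the edges at `o` force the other values. Then `g x ⊕ g y` exceeds the
      -- two values of row `o` by -2κ, which is κ modulo 3, so `g o = κ` is the right choice.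
      g : Fin m → Z₃
      g x = if x == o then κ else f o x ⊖ κ

      shape : Shape f
      shape = additive g go
        where
        solve : ∀ d a b k → d ⊖ a ⊖ b ≡ k → d ≡ (a ⊖ k) ⊕ (b ⊖ k)
        solve = toWitness {a? = all? λ d → all? λ a → all? λ b → all? λ k →
                  (d ⊖ a ⊖ b ≟ k) →-dec (d ≟ (a ⊖ k) ⊕ (b ⊖ k))} tt
        solve₀ : ∀ a k → a ≡ k ⊕ (a ⊖ k)
        solve₀ = toWitness {a? = all? λ a → all? λ k → a ≟ k ⊕ (a ⊖ k)} tt
        go : ∀ u v → u ≢ v → f u v ≡ g u ⊕ g v
        go u v uv with u ≟ o | v ≟ o
        ... | yes refl | yes refl = contradiction refl uv
        ... | yes refl | no _     = solve₀ (f u v) κ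
        ... | no _     | yes refl = trans (f-sym u v) (trans (solve₀ (f v u) κ) (⊕-comm κ _))
        ... | no uo    | no vo    = solve (f u v) (f o u) (f o v) κ (K≡κ u v uo vo uv)

  shape : Shape f
  shape with any? (λ p → any? λ q → any? λ x → any? (crossed? p q x))
  ... | yes (p , q , x , y , h) = crossed-shape h
  ... | no none with fresh [] (ℕ.≤-trans (s≤s z≤n) 5≤m)
  ...   | o , [] with fresh (o ∷ []) (ℕ.≤-trans (s≤s (s≤s z≤n)) 5≤m)
  ...     | a , (ao ∷ []) with fresh (o ∷ a ∷ []) (ℕ.≤-trans (s≤s (s≤s (s≤s z≤n))) 5≤m)
  ...       | c , (co ∷ ca ∷ []) = Parallel.shape (λ px py qx qy → decidable-stable (_ ≟ _)
                λ ne → none (_ , _ , _ , _ , px , py , qx , qy , ne)) ao co ca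

-- Placing vertices

transpose-left : ∀ {m} (i j : Fin m) → transpose i j i ≡ j
transpose-left i j rewrite dec-true (i ≟ i) refl = refl

transpose-right : ∀ {m} (i j : Fin m) → transpose i j j ≡ i
transpose-right i j with j ≟ i
... | yes j≡i = j≡i
... | no _ rewrite dec-true (j ≟ j) refl = refl

transpose-other : ∀ {m} {i j k : Fin m} → k ≢ i → k ≢ j → transpose i j k ≡ k
transpose-other {i = i} {j} {k} ki kj rewrite dec-false (k ≟ i) ki | dec-false (k ≟ j) kj = refl

transpose-injective : ∀ {m} (i j : Fin m) → Injective _≡_ _≡_ (transpose i j)
transpose-injective i j eq =
  trans (sym (transpose-inverse j i)) (trans (cong (transpose j i) eq) (transpose-inverse j i))

-- A product of transpositions: since `us` and `as` have no repetitions, the one that brings `u` to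
-- `a` moves no vertex placed earlier.
placement : ∀ {k m} (us as : Vec (Fin m) k) → Unique us → Unique as →
            ∃ λ (π : Fin m → Fin m) → Injective _≡_ _≡_ π × (∀ i → π (lookup us i) ≡ lookup as i)
placement [] [] _ _ = (λ u → u) , (λ eq → eq) , λ ()
placement (u ∷ us) (a ∷ as) (u∉ ∷ us!) (a∉ ∷ as!) with placement us as us! as!
... | π , π-inj , π-us = τ ∘ π , (λ eq → π-inj (transpose-injective (π u) a eq)) , λ where
    fzero    → transpose-left (π u) a
    (fsuc i) → trans (transpose-other (λ eq → lookup⁺ u∉ i (sym (π-inj eq)))
                                      (λ eq → lookup⁺ a∉ i (sym (trans (sym (π-us i)) eq)))) (π-us i)
  where τ = transpose (π u) a

-- Greedy choice: the two size conditions yield a place of the right kind for the first vertex, and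
-- they survive its removal.
embedding : ∀ {n m} (W : Fin n → Bool) (C : Fin m → Bool) → card W ≤ card C → card (not ∘ W) ≤ card (not ∘ C) →
            ∃ λ (φ : Fin n → Fin m) → Injective _≡_ _≡_ φ × (∀ u → C (φ u) ≡ W u)
embedding {zero} W C _ _ = (λ ()) , (λ { {()} }) , λ ()
embedding {suc n} {m} W C le le′ with target (W fzero) refl
  where
  target : ∀ b → W fzero ≡ b → ∃ λ i → C i ≡ W fzero
  target true eq = let i , Ci = card-witness C (ℕ.<-≤-trans (subst (λ b → 0 < bit b + card (W ∘ fsuc)) (sym eq) (s≤s z≤n)) le)
                   in i , trans Ci (sym eq)
  target false eq = let i , Ci = card-witness (not ∘ C) (ℕ.<-≤-trans (subst (λ b → 0 < bit (not b) + card (not ∘ W ∘ fsuc)) (sym eq) (s≤s z≤n)) le′)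
                    in i , trans (trans (sym (not-involutive (C i))) (cong not Ci)) (sym eq)
embedding {suc n} {suc m} W C le le′ | i , Ci with embedding (W ∘ fsuc) (C ∘ punchIn i)
    (ℕ.+-cancelˡ-≤ (bit (W fzero)) _ _ (ℕ.≤-trans le (ℕ.≤-reflexive (trans (card-remove C i) (cong (λ b → bit b + _) Ci)))))
    (ℕ.+-cancelˡ-≤ (bit (not (W fzero))) _ _ (ℕ.≤-trans le′ (ℕ.≤-reflexive (trans (card-remove (not ∘ C) i) (cong (λ b → bit (not b) + _) Ci)))))
... | φ , φ-inj , φ-C = ψ , ψ-inj , λ { fzero → Ci ; (fsuc u) → φ-C u }
  where
  ψ : Fin (suc n) → Fin (suc m)
  ψ fzero    = i
  ψ (fsuc u) = punchIn i (φ u)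
  ψ-inj : Injective _≡_ _≡_ ψ
  ψ-inj {fzero}  {fzero}  eq = refl
  ψ-inj {fzero}  {fsuc v} eq = contradiction (sym eq) (punchInᵢ≢i i (φ v))
  ψ-inj {fsuc u} {fzero}  eq = contradiction eq (punchInᵢ≢i i (φ u))
  ψ-inj {fsuc u} {fsuc v} eq = cong fsuc (φ-inj (punchIn-injective i _ _ eq))

sum-update : ∀ {n} (s t : Vector Z₃ n) i → (∀ k → k ≢ i → t k ≡ s k) → sum t ⊕ s i ≡ sum s ⊕ t i
sum-update {suc n} s t i t≡s = begin
  sum t ⊕ s i                          ≡⟨ cong (_⊕ s i) (sum-remove {i = i} t) ⟩
  t i ⊕ sum (removeAt t i) ⊕ s i       ≡⟨ cong (λ r → t i ⊕ r ⊕ s i) (sum-cong-≗ λ k → t≡s _ (punchInᵢ≢i i k)) ⟩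
  t i ⊕ sum (removeAt s i) ⊕ s i       ≡⟨ rearr (t i) _ (s i) ⟩
  s i ⊕ sum (removeAt s i) ⊕ t i       ≡⟨ cong (_⊕ t i) (sum-remove {i = i} s) ⟨
  sum s ⊕ t i ∎
  where
  open ≡-Reasoning
  rearr : ∀ a b c → a ⊕ b ⊕ c ≡ c ⊕ b ⊕ a
  rearr = toWitness {a? = all? λ a → all? λ b → all? λ c → a ⊕ b ⊕ c ≟ c ⊕ b ⊕ a} tt

weighted : ∀ {m} → (Fin m → Z₃) → (Fin m → Z₃) → Z₃
weighted e h = sum λ i → e i ⊗ h i

weighted-transpose : ∀ {m} (e h : Fin m → Z₃) {i j} → i ≢ j →
                     weighted e (h ∘ transpose i j) ≡ weighted e h ⊕ (e i ⊖ e j) ⊗ (h j ⊖ h i)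
weighted-transpose e h {i} {j} ij =
  solve (e i) (e j) (h i) (h j) (sum t′) (sum r) (sum t) first second
  where
  t t′ r : Vector Z₃ _
  t k = e k ⊗ h k
  t′ k = e k ⊗ h (transpose i j k)
  -- Half of the swap: the entry at `j` is exchanged, the one at `i` not yet, so that each half is a
  -- single `sum-update`.
  r k = if k == j then e k ⊗ h i else t k
  r-j : r j ≡ e j ⊗ h i
  r-j rewrite ==-refl j = refl
  r-off : ∀ k → k ≢ j → r k ≡ t k
  r-off k kj rewrite ==-≢ kj = refl
  t′-off : ∀ k → k ≢ i → t′ k ≡ r k
  t′-off k ki with k ≟ j
  ... | yes refl = cong (λ z → e k ⊗ h z) (transpose-right i k)
  ... | no kj    = cong (λ z → e k ⊗ h z) (transpose-other ki kj)
  first : sum t′ ⊕ e i ⊗ h i ≡ sum r ⊕ e i ⊗ h j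
  first = begin
    sum t′ ⊕ t i ≡⟨ cong (sum t′ ⊕_) (r-off i ij) ⟨
    sum t′ ⊕ r i ≡⟨ sum-update r t′ i t′-off ⟩
    sum r ⊕ t′ i ≡⟨ cong (λ z → sum r ⊕ e i ⊗ h z) (transpose-left i j) ⟩
    sum r ⊕ e i ⊗ h j ∎
    where open ≡-Reasoning
  second : sum r ⊕ e j ⊗ h j ≡ sum t ⊕ e j ⊗ h i
  second = trans (sum-update t r j r-off) (cong (sum t ⊕_) r-j)
  move : ∀ a b c d → a ⊕ b ≡ c ⊕ d → a ≡ c ⊕ (d ⊖ b)
  move = toWitness {a? = all? λ a → all? λ b → all? λ c → all? λ d → (a ⊕ b ≟ c ⊕ d) →-dec (a ≟ c ⊕ (d ⊖ b))} tt
  factor : ∀ ei ej hi hj s → s ⊕ (ej ⊗ hi ⊖ ej ⊗ hj) ⊕ (ei ⊗ hj ⊖ ei ⊗ hi) ≡ s ⊕ (ei ⊖ ej) ⊗ (hj ⊖ hi)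
  factor = toWitness {a? = all? λ ei → all? λ ej → all? λ hi → all? λ hj → all? λ s →
    s ⊕ (ej ⊗ hi ⊖ ej ⊗ hj) ⊕ (ei ⊗ hj ⊖ ei ⊗ hi) ≟ s ⊕ (ei ⊖ ej) ⊗ (hj ⊖ hi)} tt
  solve : ∀ ei ej hi hj t′ r t → t′ ⊕ ei ⊗ hi ≡ r ⊕ ei ⊗ hj → r ⊕ ej ⊗ hj ≡ t ⊕ ej ⊗ hi → t′ ≡ t ⊕ (ei ⊖ ej) ⊗ (hj ⊖ hi)
  solve ei ej hi hj t′ r t p q =
    trans (move t′ _ r _ p) (trans (cong (_⊕ (ei ⊗ hj ⊖ ei ⊗ hi)) (move r _ t _ q)) (factor ei ej hi hj t))

Spread : ∀ {m} → (Fin m → Z₃) → Set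
Spread g = ∃ λ a → ∃ λ a′ → ∃ λ b → ∃ λ b′ →
  a ≢ b × a ≢ b′ × a′ ≢ b × a′ ≢ b′ × g a ≢ g a′ × g b ≢ g b′

spread-or-constant : ∀ {m} → 5 ≤ m → (g : Fin m → Z₃) → Spread g ⊎ ∃ λ s → ∃ λ γ → ∀ u → u ≢ s → g u ≡ γ
spread-or-constant {m} 5≤m g with any? (λ a → any? λ a′ → any? λ b → any? λ b′ →
    ¬? (a ≟ b) ×-dec ¬? (a ≟ b′) ×-dec ¬? (a′ ≟ b) ×-dec ¬? (a′ ≟ b′) ×-dec ¬? (g a ≟ g a′) ×-dec ¬? (g b ≟ g b′))
... | yes spread = inj₁ spread
... | no tight with any? (λ a → any? λ a′ → ¬? (g a ≟ g a′))
...   | no flat with fresh [] (ℕ.≤-trans (s≤s z≤n) 5≤m)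
...     | o , [] = inj₂ (o , g o , λ u _ → decidable-stable (g u ≟ g o) λ ne → flat (u , o , ne))
spread-or-constant {m} 5≤m g | no tight | yes (a , a′ , aa′)
  with fresh (a ∷ a′ ∷ []) (ℕ.≤-trans (s≤s (s≤s (s≤s z≤n))) 5≤m)
... | c , (ca ∷ ca′ ∷ []) with fresh (a ∷ a′ ∷ c ∷ []) (ℕ.≤-trans (s≤s (s≤s (s≤s (s≤s z≤n)))) 5≤m)
...   | d , (da ∷ da′ ∷ dc ∷ []) = inj₂ (go (g a ≟ g c) (g a′ ≟ g c))
  where
  const : ∀ u → u ≢ a → u ≢ a′ → g u ≡ g c
  const u ua ua′ = decidable-stable (g u ≟ g c) λ ne →
    tight (a , a′ , u , c , ua ∘ sym , ca ∘ sym , ua′ ∘ sym , ca′ ∘ sym , aa′ , ne)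
  go : Dec (g a ≡ g c) → Dec (g a′ ≡ g c) → ∃ λ s → ∃ λ γ → ∀ u → u ≢ s → g u ≡ γ
  go (yes a≡c) _ = a′ , g c , λ u ua′ → case u ≟ a of λ where
    (yes refl) → a≡c
    (no ua)    → const u ua ua′
  go (no _) (yes a′≡c) = a , g c , λ u ua → case u ≟ a′ of λ where
    (yes refl) → a′≡c
    (no ua′)   → const u ua ua′
  -- Both `a` and `a′` deviate from the common value of the rest, so `a`, `c` and `a′`, `d` are two
  -- disjoint pairs with different values.
  go (no a≢c) (no a′≢c) = contradiction
    (a , c , a′ , d , (λ { refl → aa′ refl }) , da ∘ sym , ca′ , dc ∘ sym , a≢c , λ eq → a′≢c (trans eq (const d da da′))) tight

-- Colourings without a zero-sum copy

Opposed : (a₀ a₁ a₂ b₀ b₁ b₂ : Z₃) → Set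
Opposed a₀ a₁ a₂ b₀ b₁ b₂ = Flat (a₀ ⊕ b₀) (a₁ ⊕ b₁) (a₂ ⊕ b₂)

Rainbow : Z₃ → Z₃ → Z₃ → Set
Rainbow a b c = a ≢ b × b ≢ c × a ≢ c

flat? : ∀ a b c → Dec (Flat a b c)
flat? a b c = (a ≟ b) ×-dec (b ≟ c)

rainbow? : ∀ a b c → Dec (Rainbow a b c)
rainbow? a b c = ¬? (a ≟ b) ×-dec ¬? (b ≟ c) ×-dec ¬? (a ≟ c)

abstract
  -- The six sums are those of the placements of the two leaves on two of the three positions.
  missing-residue : ∀ k a₀ a₁ a₂ b₀ b₁ b₂ →
    (k ⊕ double b₁ ⊕ double a₀ ≢ 0F × k ⊕ double b₀ ⊕ double a₁ ≢ 0F × k ⊕ double b₂ ⊕ double a₀ ≢ 0F ×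
     k ⊕ double b₀ ⊕ double a₂ ≢ 0F × k ⊕ double b₂ ⊕ double a₁ ≢ 0F × k ⊕ double b₁ ⊕ double a₂ ≢ 0F) →
    (Rainbow a₀ a₁ a₂ × Opposed a₀ a₁ a₂ b₀ b₁ b₂) ⊎
    (¬ Rainbow a₀ a₁ a₂ × (Flat a₀ a₁ a₂ ⊎ Flat b₀ b₁ b₂ ⊎ Flat (a₀ ⊖ b₀) (a₁ ⊖ b₁) (a₂ ⊖ b₂)))
  missing-residue = toWitness {a? = all? λ k → all? λ a₀ → all? λ a₁ → all? λ a₂ → all? λ b₀ → all? λ b₁ → all? λ b₂ →
    (¬? (k ⊕ double b₁ ⊕ double a₀ ≟ 0F) ×-dec ¬? (k ⊕ double b₀ ⊕ double a₁ ≟ 0F) ×-dec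
     ¬? (k ⊕ double b₂ ⊕ double a₀ ≟ 0F) ×-dec ¬? (k ⊕ double b₀ ⊕ double a₂ ≟ 0F) ×-dec
     ¬? (k ⊕ double b₂ ⊕ double a₁ ≟ 0F) ×-dec ¬? (k ⊕ double b₁ ⊕ double a₂ ≟ 0F)) →-dec
    ((rainbow? a₀ a₁ a₂ ×-dec flat? (a₀ ⊕ b₀) (a₁ ⊕ b₁) (a₂ ⊕ b₂)) ⊎-dec
     (¬? (rainbow? a₀ a₁ a₂) ×-dec (flat? a₀ a₁ a₂ ⊎-dec flat? b₀ b₁ b₂ ⊎-dec flat? (a₀ ⊖ b₀) (a₁ ⊖ b₁) (a₂ ⊖ b₂))))} tt

  opposed-transfer : ∀ a₀ a₁ b₀ b₁ → a₀ ⊕ b₀ ≡ a₁ ⊕ b₁ → b₀ ≡ b₁ → a₀ ≡ a₁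
  opposed-transfer = toWitness {a? = all? λ a₀ → all? λ a₁ → all? λ b₀ → all? λ b₁ →
    (a₀ ⊕ b₀ ≟ a₁ ⊕ b₁) →-dec (b₀ ≟ b₁) →-dec (a₀ ≟ a₁)} tt

  -- The first two equations minus the third give 2a₀ = 2a₁.
  mutually-opposed : ∀ a₀ a₁ b₀ b₁ c₀ c₁ → a₀ ⊕ b₀ ≡ a₁ ⊕ b₁ → a₀ ⊕ c₀ ≡ a₁ ⊕ c₁ → b₀ ⊕ c₀ ≡ b₁ ⊕ c₁ → a₀ ≡ a₁
  mutually-opposed = toWitness {a? = all? λ a₀ → all? λ a₁ → all? λ b₀ → all? λ b₁ → all? λ c₀ → all? λ c₁ →
    (a₀ ⊕ b₀ ≟ a₁ ⊕ b₁) →-dec (a₀ ⊕ c₀ ≟ a₁ ⊕ c₁) →-dec (b₀ ⊕ c₀ ≟ b₁ ⊕ c₁) →-dec (a₀ ≟ a₁)} tt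

  -- A rainbow row takes every value, in particular the negative of the common sum aᵢ ⊕ bᵢ.
  rainbow-hits : ∀ a₀ a₁ a₂ b₀ b₁ b₂ → Rainbow a₀ a₁ a₂ → Opposed a₀ a₁ a₂ b₀ b₁ b₂ →
    a₁ ⊕ b₁ ⊕ a₀ ≡ 0F ⊎ a₀ ⊕ b₀ ⊕ a₁ ≡ 0F ⊎ a₀ ⊕ b₀ ⊕ a₂ ≡ 0F
  rainbow-hits = toWitness {a? = all? λ a₀ → all? λ a₁ → all? λ a₂ → all? λ b₀ → all? λ b₁ → all? λ b₂ →
    rainbow? a₀ a₁ a₂ →-dec flat? (a₀ ⊕ b₀) (a₁ ⊕ b₁) (a₂ ⊕ b₂) →-dec
    ((a₁ ⊕ b₁ ⊕ a₀ ≟ 0F) ⊎-dec (a₀ ⊕ b₀ ⊕ a₁ ≟ 0F) ⊎-dec (a₀ ⊕ b₀ ⊕ a₂ ≟ 0F))} tt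

  -- For nonzero `d` and `d′` the sums 0, d, d′, d + d′ exhaust the residues modulo 3.
  two-swaps : ∀ s d d′ → s ≢ 0F → s ⊕ d ≢ 0F → s ⊕ d′ ≢ 0F → s ⊕ d ⊕ d′ ≢ 0F → d ≡ 0F ⊎ d′ ≡ 0F
  two-swaps = toWitness {a? = all? λ s → all? λ d → all? λ d′ →
    ¬? (s ≟ 0F) →-dec ¬? (s ⊕ d ≟ 0F) →-dec ¬? (s ⊕ d′ ≟ 0F) →-dec ¬? (s ⊕ d ⊕ d′ ≟ 0F) →-dec
    ((d ≟ 0F) ⊎-dec (d′ ≟ 0F))} tt

  ⊖⊗⊖≡0 : ∀ a b c d → (a ⊖ b) ⊗ (c ⊖ d) ≡ 0F → a ≡ b ⊎ d ≡ c
  ⊖⊗⊖≡0 = toWitness {a? = all? λ a → all? λ b → all? λ c → all? λ d →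
    ((a ⊖ b) ⊗ (c ⊖ d) ≟ 0F) →-dec ((a ≟ b) ⊎-dec (d ≟ c))} tt

  pred-residue : ∀ a b → 1F ⊕ a ≡ 1F ⊕ b → a ≡ b
  pred-residue = toWitness {a? = all? λ a → all? λ b → (1F ⊕ a ≟ 1F ⊕ b) →-dec (a ≟ b)} tt

module Critical {n : ℕ} (T : Graph n) (connected : Connected T) (acyclic : ¬ HasCycle T)
  (n≡1 : ⟦ n ⟧ ≡ 1F) (4≤n : 4 ≤ n) {ℓ₁ p₁ ℓ₂ p₂ : Fin n}
  (pendant₁ : Trees.PendantEdge T connected acyclic ℓ₁ p₁)
  (pendant₂ : Trees.PendantEdge T connected acyclic ℓ₂ p₂)
  (distinct : Unique (p₁ ∷ p₂ ∷ ℓ₁ ∷ ℓ₂ ∷ []))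
  (f : Colouring (suc n)) (f-sym : ∀ u v → f u v ≡ f v u)
  (no-zero : ∀ (φ : Fin n → Fin (suc n)) → Injective _≡_ _≡_ φ →
             EdgeSums.total T (λ u w → f (φ u) (φ w)) ≢ 0F) where

  open EdgeSums T
  open Trees T connected acyclic
  open PendantEdge

  5≤ : 5 ≤ suc n
  5≤ = s≤s 4≤n

  p₁≢p₂ : p₁ ≢ p₂
  p₁≢p₂ = case distinct of λ { ((h ∷ _) ∷ _) → h }
  p₁≢ℓ₁ : p₁ ≢ ℓ₁
  p₁≢ℓ₁ = case distinct of λ { ((_ ∷ h ∷ _) ∷ _) → h }
  p₁≢ℓ₂ : p₁ ≢ ℓ₂
  p₁≢ℓ₂ = case distinct of λ { ((_ ∷ _ ∷ h ∷ _) ∷ _) → h }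
  p₂≢ℓ₁ : p₂ ≢ ℓ₁
  p₂≢ℓ₁ = case distinct of λ { (_ ∷ (h ∷ _) ∷ _) → h }
  p₂≢ℓ₂ : p₂ ≢ ℓ₂
  p₂≢ℓ₂ = case distinct of λ { (_ ∷ (_ ∷ h ∷ _) ∷ _) → h }
  ℓ₁≢ℓ₂ : ℓ₁ ≢ ℓ₂
  ℓ₁≢ℓ₂ = case distinct of λ { (_ ∷ _ ∷ (h ∷ _) ∷ _) → h }

  copy : (Fin n → Fin (suc n)) → Weight
  copy φ u w = f (φ u) (φ w)

  -- The weight without the two pendant edges; it does not depend on where the leaves are placed.
  core : Weight → Weight
  core F = cut ℓ₂ (cut ℓ₁ F)

  core-cong : ∀ {F G} u w → (u ≢ ℓ₁ → u ≢ ℓ₂ → w ≢ ℓ₁ → w ≢ ℓ₂ → F u w ≡ G u w) → core F u w ≡ core G u w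
  core-cong {F} {G} u w eq = cut-cong {cut ℓ₁ F} {cut ℓ₁ G} ℓ₂ u w λ u₂ w₂ →
    cut-cong {F} {G} ℓ₁ u w λ u₁ w₁ → eq u₁ u₂ w₁ w₂

  total-core : ∀ F → Symmetric F → total F ≡ total (core F) ⊕ double (F p₂ ℓ₂) ⊕ double (F p₁ ℓ₁)
  total-core F F-sym = begin
    total F
      ≡⟨ total-cut ℓ₁ F-sym ⟩
    total (cut ℓ₁ F) ⊕ double (row F ℓ₁)
      ≡⟨ cong₂ (λ a b → a ⊕ double b) (total-cut ℓ₂ (cut-symmetric ℓ₁ F-sym))
           (trans (row-single F (edge pendant₁) (λ w h ne → contradiction (only pendant₁ w h) ne)) (F-sym ℓ₁ p₁)) ⟩
    total (core F) ⊕ double (row (cut ℓ₁ F) ℓ₂) ⊕ double (F p₁ ℓ₁)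
      ≡⟨ cong (λ a → total (core F) ⊕ double a ⊕ double (F p₁ ℓ₁))
           (trans (row-single (cut ℓ₁ F) (edge pendant₂) (λ w h ne → contradiction (only pendant₂ w h) ne))
             (trans (cut-off F (ℓ₁≢ℓ₂ ∘ sym) p₂≢ℓ₁) (F-sym ℓ₂ p₂))) ⟩
    total (core F) ⊕ double (F p₂ ℓ₂) ⊕ double (F p₁ ℓ₁) ∎
    where open ≡-Reasoning

  module Placed {p q x y z : Fin (suc n)} (u! : Unique (p ∷ q ∷ x ∷ y ∷ z ∷ [])) where

    -- `fsuc u` stands for the vertex `u` of `T`, and `fzero` for the vertex that the copy leaves
    -- uncovered.
    sources : Vec (Fin (suc n)) 5
    sources = fsuc p₁ ∷ fsuc p₂ ∷ fsuc ℓ₁ ∷ fsuc ℓ₂ ∷ fzero ∷ []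

    sources-unique : Unique sources
    sources-unique = (lift p₁≢p₂ ∷ lift p₁≢ℓ₁ ∷ lift p₁≢ℓ₂ ∷ (λ ()) ∷ []) ∷ (lift p₂≢ℓ₁ ∷ lift p₂≢ℓ₂ ∷ (λ ()) ∷ []) ∷
      (lift ℓ₁≢ℓ₂ ∷ (λ ()) ∷ []) ∷ ((λ ()) ∷ []) ∷ [] ∷ []
      where
      lift : ∀ {u w : Fin n} → u ≢ w → fsuc u ≢ fsuc w
      lift h eq = h (suc-injective eq)

    placed = placement sources (p ∷ q ∷ x ∷ y ∷ z ∷ []) sources-unique u!

    π : Fin (suc n) → Fin (suc n)
    π = proj₁ placed

    π-inj : Injective _≡_ _≡_ π
    π-inj = proj₁ (proj₂ placed)

    π-at : ∀ i → π (lookup sources i) ≡ lookup (p ∷ q ∷ x ∷ y ∷ z ∷ []) i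
    π-at = proj₂ (proj₂ placed)

    φ : Fin n → Fin (suc n)
    φ u = π (fsuc u)

    φ[_,_] : Fin (suc n) → Fin (suc n) → Fin n → Fin (suc n)
    φ[ a , b ] u = if u == ℓ₁ then a else if u == ℓ₂ then b else φ u

    at-ℓ₁ : ∀ {a b} → φ[ a , b ] ℓ₁ ≡ a
    at-ℓ₁ rewrite ==-refl ℓ₁ = refl

    at-ℓ₂ : ∀ {a b} → φ[ a , b ] ℓ₂ ≡ b
    at-ℓ₂ rewrite ==-≢ (ℓ₁≢ℓ₂ ∘ sym) | ==-refl ℓ₂ = refl

    elsewhere : ∀ {a b u} → u ≢ ℓ₁ → u ≢ ℓ₂ → φ[ a , b ] u ≡ φ u
    elsewhere h h′ rewrite ==-≢ h | ==-≢ h′ = refl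

    -- The free positions: those of the two leaves and of the uncovered vertex.
    Free : Fin (suc n) → Set
    Free a = ∀ u → u ≢ ℓ₁ → u ≢ ℓ₂ → φ u ≢ a

    free-x : Free x
    free-x u h _ eq = h (suc-injective (π-inj (trans eq (sym (π-at (fsuc (fsuc fzero)))))))

    free-y : Free y
    free-y u _ h eq = h (suc-injective (π-inj (trans eq (sym (π-at (fsuc (fsuc (fsuc fzero))))))))

    free-z : Free z
    free-z u _ _ eq = case π-inj (trans eq (sym (π-at (fsuc (fsuc (fsuc (fsuc fzero))))))) of λ ()

    φ-injective : ∀ {a b} → Free a → Free b → a ≢ b → Injective _≡_ _≡_ φ[ a , b ]
    φ-injective fa fb ab {u} {w} eq with u ≟ ℓ₁ | w ≟ ℓ₁
    ... | yes refl | yes refl = refl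
    ... | yes refl | no w₁ with w ≟ ℓ₂
    ...   | yes refl = contradiction eq ab
    ...   | no w₂    = contradiction (sym eq) (fa w w₁ w₂)
    φ-injective fa fb ab {u} {w} eq | no u₁ | yes refl with u ≟ ℓ₂
    ...   | yes refl = contradiction (sym eq) ab
    ...   | no u₂    = contradiction eq (fa u u₁ u₂)
    φ-injective fa fb ab {u} {w} eq | no u₁ | no w₁ with u ≟ ℓ₂ | w ≟ ℓ₂
    ...   | yes refl | yes refl = refl
    ...   | yes refl | no w₂    = contradiction (sym eq) (fb w w₁ w₂)
    ...   | no u₂    | yes refl = contradiction eq (fb u u₁ u₂)
    ...   | no _     | no _     = suc-injective (π-inj eq)

    rest : Z₃
    rest = total (core (copy φ))

    total-placed : ∀ a b → total (copy φ[ a , b ]) ≡ rest ⊕ double (f q b) ⊕ double (f p a)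
    total-placed a b = trans (total-core (copy φ[ a , b ]) λ u w → f-sym (φ[ a , b ] u) (φ[ a , b ] w)) (cong₂ _⊕_ (cong₂ _⊕_
        (total-cong λ u w _ → core-cong {copy φ[ a , b ]} {copy φ} u w λ u₁ u₂ w₁ w₂ → cong₂ f (elsewhere u₁ u₂) (elsewhere w₁ w₂))
        (cong double (cong₂ f (trans (elsewhere p₂≢ℓ₁ p₂≢ℓ₂) (π-at (fsuc fzero))) at-ℓ₂)))
        (cong double (cong₂ f (trans (elsewhere p₁≢ℓ₁ p₁≢ℓ₂) (π-at fzero)) at-ℓ₁)))

    nonzero : ∀ {a b} → Free a → Free b → a ≢ b → rest ⊕ double (f q b) ⊕ double (f p a) ≢ 0F
    nonzero {a} {b} fa fb ab eq = no-zero φ[ a , b ] (φ-injective fa fb ab) (trans (total-placed a b) eq)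

    cases : (Rainbow (f p x) (f p y) (f p z) × Opposed (f p x) (f p y) (f p z) (f q x) (f q y) (f q z)) ⊎
            (¬ Rainbow (f p x) (f p y) (f p z) × (Flat (f p x) (f p y) (f p z) ⊎ Flat (f q x) (f q y) (f q z) ⊎
              Flat (f p x ⊖ f q x) (f p y ⊖ f q y) (f p z ⊖ f q z)))
    cases = case u! of λ { (_ ∷ _ ∷ (xy ∷ xz ∷ []) ∷ (yz ∷ []) ∷ _) → missing-residue rest (f p x) (f p y) (f p z) (f q x) (f q y) (f q z)
      ( nonzero free-x free-y xy , nonzero free-y free-x (xy ∘ sym) , nonzero free-x free-z xz
      , nonzero free-z free-x (xz ∘ sym) , nonzero free-y free-z yz , nonzero free-z free-y (yz ∘ sym) ) }

    opposed : Rainbow (f p x) (f p y) (f p z) → Opposed (f p x) (f p y) (f p z) (f q x) (f q y) (f q z)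
    opposed r with cases
    ... | inj₁ (_ , o)  = o
    ... | inj₂ (¬r , _) = contradiction r ¬r

  -- A row opposed to a rainbow row is itself rainbow. So rows `q` and `e`, both opposed to row `p`,
  -- are also opposed to each other, and `mutually-opposed` applies.
  no-rainbow-large : 5 ≤ n → ∀ {p q x y z} → Unique (p ∷ q ∷ x ∷ y ∷ z ∷ []) → ¬ Rainbow (f p x) (f p y) (f p z)
  no-rainbow-large 5≤n {p} {q} {x} {y} {z} u!@((pq ∷ px ∷ py ∷ pz ∷ []) ∷ (qx ∷ qy ∷ qz ∷ []) ∷ u!′) r@(xy , yz , xz)
    with fresh (p ∷ q ∷ x ∷ y ∷ z ∷ []) (s≤s 5≤n)
  ... | e , (ep ∷ eq ∷ ex ∷ ey ∷ ez ∷ []) =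
    xy (mutually-opposed (f p x) (f p y) (f q x) (f q y) (f e x) (f e y) (proj₁ o) (proj₁ o′) (proj₁ o″))
    where
    o  = Placed.opposed u! r
    o′ = Placed.opposed {p} {e} ((ep ∘ sym ∷ px ∷ py ∷ pz ∷ []) ∷ (ex ∷ ey ∷ ez ∷ []) ∷ u!′) r
    o″ = Placed.opposed {q} {e} ((eq ∘ sym ∷ qx ∷ qy ∷ qz ∷ []) ∷ (ex ∷ ey ∷ ez ∷ []) ∷ u!′)
      ( (λ h → xy (opposed-transfer (f p x) (f p y) (f q x) (f q y) (proj₁ o) h))
      , (λ h → yz (opposed-transfer (f p y) (f p z) (f q y) (f q z) (proj₂ o) h))
      , (λ h → xz (opposed-transfer (f p x) (f p z) (f q x) (f q z) (trans (proj₁ o) (proj₂ o)) h)) )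

  -- Some colourings of K₅ with a rainbow row pass every test that only moves the two leaves; here T is the path
  -- ℓ₁ p₁ p₂ ℓ₂, which can also be placed so that p lies on p₁, q on ℓ₂ and p₂ on one of x, y, z.
  module Path₄ (n<5 : n < 5) where

    covers : ∀ u → u ≢ p₁ → u ≢ p₂ → u ≢ ℓ₁ → u ≡ ℓ₂
    covers u h h′ h″ = decidable-stable (u ≟ ℓ₂) λ h‴ → ℕ.<⇒≱ n<5
      (injective⇒≤ (λ {i} {j} → lookup-injective ((h ∷ h′ ∷ h″ ∷ h‴ ∷ []) ∷ distinct) i j))

    p₁≁ℓ₂ : ¬ E T p₁ ℓ₂
    p₁≁ℓ₂ e = p₁≢p₂ (only pendant₂ _ (E-sym T e))

    -- Some edge leaves the set of `ℓ₁` and `p₁`. It cannot start at the leaf `ℓ₁` nor end at `ℓ₂`,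
    -- which hangs at `p₂`.
    spine : E T p₁ p₂
    spine with exit-edge {T = T} (insert ℓ₁ (_== p₁)) (connected p₁ p₂) (insert-⊇ ℓ₁ (_== p₁) {p₁} (==-refl p₁))
                 (trans (insert-there (_== p₁) p₂≢ℓ₁) (==-≢ (p₁≢p₂ ∘ sym)))
    ... | p , y , p∈ , y∉ , e = go (p ≟ ℓ₁) (p ≟ p₁) (y ≟ p₁) (y ≟ ℓ₁) (y ≟ p₂)
      where
      go : Dec (p ≡ ℓ₁) → Dec (p ≡ p₁) → Dec (y ≡ p₁) → Dec (y ≡ ℓ₁) → Dec (y ≡ p₂) → E T p₁ p₂
      go _ _ (yes refl) _ _ = contradiction y∉ (true≢false (insert-⊇ ℓ₁ (_== p₁) {p₁} (==-refl p₁)))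
      go _ _ _ (yes refl) _ = contradiction y∉ (true≢false (insert-here ℓ₁ (_== p₁)))
      go (yes refl) _ (no yp) _ _ = contradiction (only pendant₁ y e) yp
      go _ (yes refl) _ _ (yes refl) = e
      go _ (yes refl) (no h) (no h′) (no h″) = contradiction (subst (E T p₁) (covers y h h″ h′) e) p₁≁ℓ₂
      go (no h) (no h′) _ _ _ =
        contradiction (trans (insert-there {y = ℓ₁} {p} (_== p₁) h) (==-≢ h′)) (true≢false p∈)

    cut-atˡ : ∀ v F w → cut v F v w ≡ 0F
    cut-atˡ v F w rewrite ==-refl v = refl

    cut-atʳ : ∀ v F u → cut v F u v ≡ 0F
    cut-atʳ v F u rewrite ==-refl v with u == v
    ... | true  = refl
    ... | false = refl

    cut-zero : ∀ v {F u w} → F u w ≡ 0F → cut v F u w ≡ 0F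
    cut-zero v {F} {u} {w} eq with (u == v) ∨ (w == v)
    ... | true  = refl
    ... | false = eq

    total-path : ∀ F → Symmetric F → total F ≡ double (F p₁ p₂) ⊕ double (F p₂ ℓ₂) ⊕ double (F p₁ ℓ₁)
    total-path F F-sym = trans (total-core F F-sym) (cong (λ a → a ⊕ double (F p₂ ℓ₂) ⊕ double (F p₁ ℓ₁)) (begin
      total (core F)
        ≡⟨ total-cut p₁ (cut-symmetric ℓ₂ (cut-symmetric ℓ₁ F-sym)) ⟩
      total (cut p₁ (core F)) ⊕ double (row (core F) p₁)
        ≡⟨ cong₂ (λ a b → a ⊕ double b) (total-zero _ vanish) (trans (row-single (core F) spine others)
             (trans (cut-off (cut ℓ₁ F) p₁≢ℓ₂ p₂≢ℓ₂) (cut-off F p₁≢ℓ₁ p₂≢ℓ₁))) ⟩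
      double (F p₁ p₂) ∎))
      where
      open ≡-Reasoning
      others : ∀ w → E T p₁ w → w ≢ p₂ → core F p₁ w ≡ 0F
      others w e h = case w ≟ ℓ₁ of λ where
        (yes refl) → cut-zero ℓ₂ {cut ℓ₁ F} {p₁} {w} (cut-atʳ ℓ₁ F p₁)
        (no h′)    → contradiction (subst (E T p₁) (covers w (E-irrefl T e ∘ sym) h h′) e) p₁≁ℓ₂
      left : ∀ u w → u ≢ p₂ → cut p₁ (core F) u w ≡ 0F
      left u w h = go (u ≟ p₁) (u ≟ ℓ₁)
        where
        go : Dec (u ≡ p₁) → Dec (u ≡ ℓ₁) → cut p₁ (core F) u w ≡ 0F
        go (yes refl) _ = cut-atˡ p₁ (core F) w
        go (no _) (yes refl) = cut-zero p₁ {core F} {u} {w} (cut-zero ℓ₂ {cut ℓ₁ F} {u} {w} (cut-atˡ ℓ₁ F w))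
        go (no h₁) (no h₂) = subst (λ u → cut p₁ (core F) u w ≡ 0F) (sym (covers u h₁ h h₂))
          (cut-zero p₁ {core F} {ℓ₂} {w} (cut-atˡ ℓ₂ (cut ℓ₁ F) w))
      vanish : ∀ u w → u ≢ w → cut p₁ (core F) u w ≡ 0F
      vanish u w uw = case u ≟ p₂ of λ where
        (no h)     → left u w h
        (yes refl) → trans (cut-symmetric p₁ (cut-symmetric ℓ₂ (cut-symmetric ℓ₁ F-sym)) u w) (left w u (uw ∘ sym))

    -- The copy is the path `a b c d`, with `e` uncovered.
    no-path : ∀ {a b c d e} → Unique (b ∷ c ∷ a ∷ d ∷ e ∷ []) → f b c ⊕ f c d ⊕ f b a ≢ 0F
    no-path {a} {b} {c} {d} {e} u! eq = no-zero φ (suc-injective ∘ π-inj) (begin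
      total (copy φ)
        ≡⟨ total-path (copy φ) (λ u w → f-sym (φ u) (φ w)) ⟩
      double (copy φ p₁ p₂) ⊕ double (copy φ p₂ ℓ₂) ⊕ double (copy φ p₁ ℓ₁)
        ≡⟨ cong₂ _⊕_ (cong₂ (λ r s → double r ⊕ double s) (cong₂ f (π-at 0F) (π-at 1F)) (cong₂ f (π-at 1F) (π-at (fsuc 2F))))
                     (cong double (cong₂ f (π-at 0F) (π-at 2F))) ⟩
      double (f b c) ⊕ double (f c d) ⊕ double (f b a)
        ≡⟨ collect (f b c) (f c d) (f b a) ⟩
      double (f b c ⊕ f c d ⊕ f b a)
        ≡⟨ cong double eq ⟩
      0F ∎)
      where
      open ≡-Reasoning
      open Placed u!
      collect : ∀ r s t → double r ⊕ double s ⊕ double t ≡ double (r ⊕ s ⊕ t)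
      collect = toWitness {a? = all? λ r → all? λ s → all? λ t → double r ⊕ double s ⊕ double t ≟ double (r ⊕ s ⊕ t)} tt

    no-rainbow-small : ∀ {p q x y z} → Unique (p ∷ q ∷ x ∷ y ∷ z ∷ []) → ¬ Rainbow (f p x) (f p y) (f p z)
    no-rainbow-small {p} {q} {x} {y} {z} u!@((pq ∷ px ∷ py ∷ pz ∷ []) ∷ (qx ∷ qy ∷ qz ∷ []) ∷ (xy ∷ xz ∷ []) ∷ (yz ∷ []) ∷ [] ∷ []) r
      = go (rainbow-hits (f p x) (f p y) (f p z) (f q x) (f q y) (f q z) r (Placed.opposed u! r))
      where
      go : f p y ⊕ f q y ⊕ f p x ≡ 0F ⊎ f p x ⊕ f q x ⊕ f p y ≡ 0F ⊎ f p x ⊕ f q x ⊕ f p z ≡ 0F → ⊥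
      -- On the path `x p y q` the two edges at `y` give the common sum of the two rows, and `xp`
      -- its negative. The other cases permute `x`, `y`, `z`.
      go (inj₁ h) = no-path {x} {p} {y} {q} {z}
        ((py ∷ px ∷ pq ∷ pz ∷ []) ∷ (xy ∘ sym ∷ qy ∘ sym ∷ yz ∷ []) ∷ (qx ∘ sym ∷ xz ∷ []) ∷ (qz ∷ []) ∷ [] ∷ [])
        (trans (cong (λ a → f p y ⊕ a ⊕ f p x) (f-sym y q)) h)
      go (inj₂ (inj₁ h)) = no-path {y} {p} {x} {q} {z}
        ((px ∷ py ∷ pq ∷ pz ∷ []) ∷ (xy ∷ qx ∘ sym ∷ xz ∷ []) ∷ (qy ∘ sym ∷ yz ∷ []) ∷ (qz ∷ []) ∷ [] ∷ [])
        (trans (cong (λ a → f p x ⊕ a ⊕ f p y) (f-sym x q)) h)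
      go (inj₂ (inj₂ h)) = no-path {z} {p} {x} {q} {y}
        ((px ∷ pz ∷ pq ∷ py ∷ []) ∷ (xz ∷ qx ∘ sym ∷ xy ∷ []) ∷ (qz ∘ sym ∷ yz ∘ sym ∷ []) ∷ (qy ∷ []) ∷ [] ∷ [])
        (trans (cong (λ a → f p x ⊕ a ⊕ f p z) (f-sym x q)) h)

  local : Local f
  local u! with Placed.cases u!
  ... | inj₂ (_ , s) = s
  ... | inj₁ (r , _) with 5 ℕ.≤? n
  ...   | yes 5≤n = contradiction r (no-rainbow-large 5≤n u!)
  ...   | no n<5  = contradiction r (Path₄.no-rainbow-small (ℕ.≰⇒> n<5) u!)

  -- `T` has n - 1 edges, a multiple of 3; hence a constant added to the colouring changes no total.
  total-one≡0 : total (λ _ _ → 1F) ≡ 0F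
  total-one≡0 with n ℕ.≟ suc (pred n)
  ... | yes eq = trans (total-one p₁ eq) (cong double (pred-residue ⟦ pred n ⟧ 0F (trans (sym (cong ⟦_⟧ eq)) n≡1)))
  ... | no ne  = contradiction (sym (ℕ.suc-pred n {{>-nonZero (ℕ.<-≤-trans (s≤s z≤n) 4≤n)}})) ne

  total-const : ∀ b → total (λ _ _ → b) ≡ 0F
  total-const b = begin
    total (λ _ _ → b)        ≡⟨ total-cong (λ _ _ _ → sym (⊗-comm b 1F)) ⟩
    total (λ _ _ → b ⊗ 1F)   ≡⟨ total-⊗ b (λ _ _ → 1F) ⟩
    b ⊗ total (λ _ _ → 1F)   ≡⟨ cong (b ⊗_) total-one≡0 ⟩
    b ⊗ 0F                   ≡⟨ ⊗-zeroʳ b ⟩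
    0F                       ∎
    where open ≡-Reasoning

  no-star : ∀ s b → ¬ (∀ u v → u ≢ v → u ≢ s → v ≢ s → f u v ≡ b)
  no-star s b h with placement (fzero ∷ []) (s ∷ []) ([] ∷ []) ([] ∷ [])
  ... | π , π-inj , π-at = no-zero (π ∘ fsuc) (suc-injective ∘ π-inj)
        (trans (total-cong λ u w uw → h _ _ (uw ∘ suc-injective ∘ π-inj) (off u) (off w)) (total-const b))
    where
    off : ∀ u → π (fsuc u) ≢ s
    off u eq = case π-inj (trans eq (sym (π-at fzero))) of λ ()

  degree-pendant : ∀ {ℓ p} → PendantEdge ℓ p → degree ℓ ≡ 1F
  degree-pendant {ℓ} P = trans (degree-row ℓ)
    (row-single (λ _ _ → 1F) (edge P) λ w e ne → contradiction (only P w e) ne)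

  sum-ones : ∀ k → sum {k} (λ _ → 1F) ≡ ⟦ k ⟧
  sum-ones zero    = refl
  sum-ones (suc k) = cong (1F ⊕_) (sum-ones k)

  -- The degrees add up to 2(n - 1) ≡ 0, whereas `n` degrees ≡ 1 would add up to 1.
  branching : ∃ λ x → degree x ≢ 1F
  branching with any? (λ x → ¬? (degree x ≟ 1F))
  ... | yes h = h
  ... | no none = contradiction (trans (sym total-one≡0) (trans (sum-cong-≗ ones) (trans (sum-ones n) n≡1))) λ ()
    where
    ones : ∀ u → row (λ _ _ → 1F) u ≡ 1F
    ones u = trans (sym (degree-row u)) (decidable-stable (degree u ≟ 1F) λ ne → none (u , ne))

  x : Fin n
  x = proj₁ branching

  degree-x≢1 : degree x ≢ 1F
  degree-x≢1 = proj₂ branching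

  ≢x : ∀ {ℓ p} → PendantEdge ℓ p → ℓ ≢ x
  ≢x P eq = degree-x≢1 (trans (cong degree (sym eq)) (degree-pendant P))

  -- The uncovered vertex acts as a vertex of degree zero.
  degree⁺ : Fin (suc n) → Z₃
  degree⁺ fzero    = 0F
  degree⁺ (fsuc u) = degree u

  module Additive (g : Fin (suc n) → Z₃) (f≡g : ∀ u v → u ≢ v → f u v ≡ g u ⊕ g v) where

    weighted≢0 : ∀ (π : Fin (suc n) → Fin (suc n)) → Injective _≡_ _≡_ π → weighted degree⁺ (g ∘ π) ≢ 0F
    weighted≢0 π π-inj eq = no-zero (π ∘ fsuc) (suc-injective ∘ π-inj)
      (trans (total-cong λ u w uw → f≡g _ _ (uw ∘ suc-injective ∘ π-inj))
        (trans (total-additive (g ∘ π ∘ fsuc)) (cong double eq)))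

    -- The uncovered vertex and `ℓ₁` have degrees 0 and 1; `ℓ₂` and `x` have degree 1 and a degree ≢
    -- 1. With these pairs placed on the two pairs that `g` separates, either swap changes the sum.
    no-spread : ¬ Spread g
    no-spread (a , a′ , b , b′ , ab , ab′ , a′b , a′b′ , ga , gb)
      with placement (fzero ∷ fsuc ℓ₁ ∷ fsuc ℓ₂ ∷ fsuc x ∷ []) (a ∷ a′ ∷ b ∷ b′ ∷ [])
             (((λ ()) ∷ (λ ()) ∷ (λ ()) ∷ []) ∷ (ℓ₁≢ℓ₂ ∘ suc-injective ∷ ≢x pendant₁ ∘ suc-injective ∷ []) ∷
               (≢x pendant₂ ∘ suc-injective ∷ []) ∷ [] ∷ [])
             (((λ { refl → ga refl }) ∷ ab ∷ ab′ ∷ []) ∷ (a′b ∷ a′b′ ∷ []) ∷ ((λ { refl → gb refl }) ∷ []) ∷ [] ∷ [])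
    ... | π , π-inj , π-at = refute (two-swaps (S π) d d′ (weighted≢0 π π-inj)
            (λ eq → weighted≢0 (π ∘ τ) (τ-inj ∘ π-inj) (trans swap₁ eq))
            (λ eq → weighted≢0 (π ∘ τ′) (τ′-inj ∘ π-inj) (trans swap₂ eq))
            (λ eq → weighted≢0 (π ∘ τ ∘ τ′) (τ′-inj ∘ τ-inj ∘ π-inj) (trans swap₁₂ eq)))
      where
      S : (Fin (suc n) → Fin (suc n)) → Z₃
      S ρ = weighted degree⁺ (g ∘ ρ)
      τ τ′ : Fin (suc n) → Fin (suc n)
      τ  = transpose fzero (fsuc ℓ₁)
      τ′ = transpose (fsuc ℓ₂) (fsuc x)
      τ-inj : Injective _≡_ _≡_ τ
      τ-inj = transpose-injective fzero (fsuc ℓ₁)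
      τ′-inj : Injective _≡_ _≡_ τ′
      τ′-inj = transpose-injective (fsuc ℓ₂) (fsuc x)
      d d′ : Z₃
      d  = (0F ⊖ degree ℓ₁) ⊗ (g (π (fsuc ℓ₁)) ⊖ g (π fzero))
      d′ = (degree ℓ₂ ⊖ degree x) ⊗ (g (π (fsuc x)) ⊖ g (π (fsuc ℓ₂)))
      swap₁ : S (π ∘ τ) ≡ S π ⊕ d
      swap₁ = weighted-transpose degree⁺ (g ∘ π) {fzero} {fsuc ℓ₁} (λ ())
      ℓ₂≢x : fsuc ℓ₂ ≢ fsuc x
      ℓ₂≢x eq = ≢x pendant₂ (suc-injective eq)
      swap₂ : S (π ∘ τ′) ≡ S π ⊕ d′
      swap₂ = weighted-transpose degree⁺ (g ∘ π) ℓ₂≢x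
      fixed : ∀ {u} → fsuc u ≢ fsuc ℓ₁ → π (τ (fsuc u)) ≡ π (fsuc u)
      fixed h = cong π (transpose-other {i = fzero} (λ ()) h)
      swap₁₂ : S (π ∘ τ ∘ τ′) ≡ S π ⊕ d ⊕ d′
      swap₁₂ = trans (weighted-transpose degree⁺ (g ∘ π ∘ τ) ℓ₂≢x) (cong₂ _⊕_ swap₁
        (cong₂ (λ v w → (degree ℓ₂ ⊖ degree x) ⊗ (g v ⊖ g w))
          (fixed (≢x pendant₁ ∘ sym ∘ suc-injective)) (fixed (ℓ₁≢ℓ₂ ∘ sym ∘ suc-injective))))
      refute : ¬ (d ≡ 0F ⊎ d′ ≡ 0F)
      refute (inj₁ eq) with ⊖⊗⊖≡0 0F (degree ℓ₁) (g (π (fsuc ℓ₁))) (g (π fzero)) eq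
      ... | inj₁ h = contradiction (trans h (degree-pendant pendant₁)) λ ()
      ... | inj₂ h = ga (trans (cong g (sym (π-at 0F))) (trans h (cong g (π-at 1F))))
      refute (inj₂ eq) with ⊖⊗⊖≡0 (degree ℓ₂) (degree x) (g (π (fsuc x))) (g (π (fsuc ℓ₂))) eq
      ... | inj₁ h = degree-x≢1 (trans (sym h) (degree-pendant pendant₂))
      ... | inj₂ h = gb (trans (cong g (sym (π-at 2F))) (trans h (cong g (π-at (fsuc 2F)))))

    impossible : ⊥
    impossible with spread-or-constant 5≤ g
    ... | inj₁ spread = no-spread spread
    ... | inj₂ (s , γ , const) = no-star s (γ ⊕ γ) λ u v uv us vs →
          trans (f≡g u v uv) (cong₂ _⊕_ (const u us) (const v vs))

  module Clique (C : Fin (suc n) → Bool) (a b : Z₃) (f≡ : ∀ u v → u ≢ v → f u v ≡ (if C u ∧ C v then a else b)) where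

    -- The uncovered vertex lies outside `C` if the sizes agree, and inside if `C` has one vertex
    -- more. The colouring is `b` plus a multiple of the indicator of pairs inside `C`, and the
    -- constant part sums to 0.
    no-balanced : ∀ W → card W ≤ card C → card C ≤ suc (card W) → total (within W) ≢ 0F
    no-balanced W W≤C C≤W eq with embedding W C W≤C (ℕ.+-cancelˡ-≤ (suc (card W)) _ _ (begin
        suc (card W + card (not ∘ W))     ≡⟨ cong suc (card-∁ W) ⟩
        suc n                             ≡⟨ card-∁ C ⟨
        card C + card (not ∘ C)           ≤⟨ ℕ.+-monoˡ-≤ _ C≤W ⟩
        suc (card W) + card (not ∘ C)     ∎))
      where open ℕ.≤-Reasoning
    ... | φ , φ-inj , φ-C = no-zero φ φ-inj (begin
      total (copy φ)
        ≡⟨ total-cong (λ u w uw → trans (f≡ _ _ (uw ∘ φ-inj)) (trans (cong₂ (λ c d → if c ∧ d then a else b) (φ-C u) (φ-C w)) (pt (W u) (W w)))) ⟩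
      total (λ u w → b ⊕ (a ⊖ b) ⊗ within W u w)
        ≡⟨ total-⊕ (λ _ _ → b) (λ u w → (a ⊖ b) ⊗ within W u w) ⟩
      total (λ _ _ → b) ⊕ total (λ u w → (a ⊖ b) ⊗ within W u w)
        ≡⟨ cong₂ _⊕_ (total-const b) (total-⊗ (a ⊖ b) (within W)) ⟩
      (a ⊖ b) ⊗ total (within W)
        ≡⟨ trans (cong ((a ⊖ b) ⊗_) eq) (⊗-zeroʳ (a ⊖ b)) ⟩
      0F ∎)
      where
      open ≡-Reasoning
      in-C : ∀ a b → a ≡ b ⊕ (a ⊖ b) ⊗ 1F
      in-C = toWitness {a? = all? λ a → all? λ b → a ≟ b ⊕ (a ⊖ b) ⊗ 1F} tt
      off-C : b ≡ b ⊕ (a ⊖ b) ⊗ 0F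
      off-C = sym (trans (cong (b ⊕_) (⊗-zeroʳ (a ⊖ b))) (⊕-identityʳ b))
      pt : ∀ c d → (if c ∧ d then a else b) ≡ b ⊕ (a ⊖ b) ⊗ (c ▹ d ▹ 1F)
      pt true  true  = in-C a b
      pt true  false = off-C
      pt false _     = off-C

    k : ℕ
    k = card C

    k≤ : k ≤ suc n
    k≤ = card≤ C

    k≢1+n : ⟦ k ⟧ ≢ 2F → k ≢ suc n
    k≢1+n h eq = h (trans (cong ⟦_⟧ eq) (cong (1F ⊕_) n≡1))

    k≤n : ⟦ k ⟧ ≢ 2F → k ≤ n
    k≤n h = ℕ.≤-pred (ℕ.≤∧≢⇒< k≤ (k≢1+n h))

    connected-case : ∀ j → suc j ≤ n → suc j ≤ k → k ≤ suc (suc j) → ⟦ j ⟧ ≢ 0F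
    connected-case j j<n j<k k≤j j≡0 = no-balanced (Grown.W G)
        (subst (_≤ k) (sym (Grown.size G)) j<k) (subst (λ c → k ≤ suc c) (sym (Grown.size G)) k≤j)
        (trans (Grown.edges G) (cong double j≡0))
      where G = grow x j j<n

    punctured-case : ∀ j → suc j ≤ n → j ≤ k → k ≤ suc j → ⟦ j ⟧ ≢ degree x
    punctured-case j j<n j≤k k≤j eq with punctured x j j<n
    ... | V , size , e = no-balanced V (subst (_≤ k) (sym size) j≤k) (subst (λ c → k ≤ suc c) (sym size) k≤j) (go e)
      where
      cancel : ∀ a b → a ⊕ double b ≡ double b → a ≡ 0F
      cancel = toWitness {a? = all? λ a → all? λ b → (a ⊕ double b ≟ double b) →-dec (a ≟ 0F)} tt
      go : total (within V) ≡ 0F ⊎ total (within V) ⊕ double (degree x) ≡ double ⟦ j ⟧ → total (within V) ≡ 0F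
      go (inj₁ h) = h
      go (inj₂ h) = cancel _ (degree x) (trans h (cong double eq))

    impossible : ⊥
    impossible = go k refl ⟦ k ⟧ refl
      where
      by-degree : ∀ j → k ≡ suc j → ⟦ k ⟧ ≡ 0F → ∀ d → degree x ≡ d → ⊥
      -- Before the removal of `x` the subtree has one vertex more than `C`. It fits, because `k` ≡
      -- 0 is neither `n` ≡ 1 nor `suc n` ≡ 2.
      by-degree j eq k≡0 0F d≡ = punctured-case k
        (ℕ.≤∧≢⇒< (k≤n (λ h → contradiction (trans (sym k≡0) h) λ ())) λ k≡n →
          contradiction (trans (sym k≡0) (trans (cong ⟦_⟧ k≡n) n≡1)) λ ())
        ℕ.≤-refl (ℕ.n≤1+n k) (trans k≡0 (sym d≡))
      by-degree j eq k≡0 1F d≡ = degree-x≢1 d≡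
      by-degree j eq k≡0 2F d≡ = punctured-case j
        (subst (_≤ n) eq (k≤n (λ h → contradiction (trans (sym k≡0) h) λ ())))
        (ℕ.≤-trans (ℕ.n≤1+n j) (ℕ.≤-reflexive (sym eq))) (ℕ.≤-reflexive eq)
        (trans (pred-residue ⟦ j ⟧ 2F (trans (sym (cong ⟦_⟧ eq)) k≡0)) (sym d≡))
      go : ∀ c → k ≡ c → ∀ r → ⟦ k ⟧ ≡ r → ⊥
      go zero eq _ _ = no-balanced (λ _ → false) (subst (_≤ k) (sym (card-replicate-false n)) z≤n)
        (ℕ.≤-trans (ℕ.≤-reflexive eq) z≤n) (total-zero _ λ _ _ _ → refl)
      go (suc j) eq 0F k≡ = by-degree j eq k≡ (degree x) refl
      go (suc j) eq 1F k≡ = connected-case j (subst (_≤ n) eq (k≤n (λ h → contradiction (trans (sym k≡) h) λ ())))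
        (ℕ.≤-reflexive (sym eq)) (ℕ.≤-trans (ℕ.≤-reflexive eq) (ℕ.n≤1+n _))
        (pred-residue ⟦ j ⟧ 0F (trans (sym (cong ⟦_⟧ eq)) k≡))
      go (suc zero) eq 2F k≡ = contradiction (trans (sym k≡) (cong ⟦_⟧ eq)) λ ()
      go (suc (suc j)) eq 2F k≡ = connected-case j (ℕ.≤-pred (subst (_≤ suc n) eq k≤))
        (ℕ.≤-trans (ℕ.n≤1+n _) (ℕ.≤-reflexive (sym eq))) (ℕ.≤-reflexive eq)
        (pred-residue ⟦ j ⟧ 0F (pred-residue _ 1F (trans (sym (cong ⟦_⟧ eq)) k≡)))

  contradictory : ⊥
  contradictory with Structure.shape 5≤ f f-sym local
  ... | star s b h     = no-star s b h
  ... | clique C a b h = Clique.impossible C a b h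
  ... | additive g h   = Additive.impossible g h

-- The value of R

deg-card : ∀ {n} (T : Graph n) v → deg T v ≡ card (adj T v)
deg-card T v = trans (cong sumᴸ (map-tabulate (λ w → w) (bit ∘ adj T v))) (go (adj T v))
  where
  go : ∀ {n} (W : Fin n → Bool) → sumᴸ (tabulate (bit ∘ W)) ≡ card W
  go {zero}  W = refl
  go {suc n} W = cong (bit (W fzero) +_) (go (W ∘ fsuc))

-- From a switchable pendant to two pendant edges

module _ {n : ℕ} (T : Graph n) (connected : Connected T) (acyclic : ¬ HasCycle T) where

  open Trees T connected acyclic
  open PendantEdge

  leaf-criterion : ∀ {v u} → E T v u → (∀ w → E T v w → w ≡ u) → Leaf T v
  leaf-criterion {v} {u} vu only = trans (deg-card T v)
    (trans (card-flip {V = adj T v} {W = λ _ → false} u refl vu off) (cong suc (card-replicate-false n)))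
    where
    off : ∀ w → w ≢ u → adj T v w ≡ false
    off w h with adj T v w in eq
    ... | true  = contradiction (only w eq) h
    ... | false = refl

  TwoPendants : Set
  TwoPendants = ∃ λ ℓ₁ → ∃ λ p₁ → ∃ λ ℓ₂ → ∃ λ p₂ →
    PendantEdge ℓ₁ p₁ × PendantEdge ℓ₂ p₂ × Unique (p₁ ∷ p₂ ∷ ℓ₁ ∷ ℓ₂ ∷ [])

  -- The leaf reached last from `v` hangs at some `p₁`. If `p₁` has a non-neighbour, the leaf
  -- reached last from `p₁` is not adjacent to `p₁` and hangs elsewhere. Such a non-neighbour is `v`
  -- itself or, when `v` is adjacent to `p₁`, a second neighbour of the non-leaf `v`.
  two-pendants : ∀ {j} → n ≡ suc (suc j) → ∀ {v y} → ¬ Leaf T v → y ≢ v → ¬ E T v y → TwoPendants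
  two-pendants n≡ {v} {y} v-inner y≢v v≁y with far-leaf v n≡
  ... | ℓ₁ , p₁ , P₁ , ℓ₁≢v , far with elsewhere
    where
    elsewhere : ∃ λ z → z ≢ p₁ × ¬ E T p₁ z
    elsewhere with adj T p₁ v ≟ᵇ true
    ... | no p₁≁v = v , (λ v≡p₁ → far y y≢v v≁y (subst (λ u → E T u ℓ₁) (sym v≡p₁) (E-sym T (edge P₁)))) , p₁≁v
    ... | yes p₁v with any? (λ u → (adj T v u ≟ᵇ true) ×-dec ¬? (u ≟ p₁))
    ...   | yes (u , vu , u≢p₁) = u , u≢p₁ , no-triangle (E-sym T p₁v) vu
    ...   | no none = contradiction (leaf-criterion (E-sym T p₁v)
              λ w vw → decidable-stable (w ≟ p₁) λ h → none (w , vw , h)) v-inner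
  ...   | z , z≢p₁ , p₁≁z with far-leaf p₁ n≡
  ...     | ℓ₂ , p₂ , P₂ , ℓ₂≢p₁ , far′ = ℓ₁ , p₁ , ℓ₂ , p₂ , P₁ , P₂ ,
    ((p₁≢p₂ ∷ E-irrefl T (edge P₁) ∘ sym ∷ ℓ₂≢p₁ ∘ sym ∷ []) ∷ (p₂≢ℓ₁ ∷ E-irrefl T (edge P₂) ∘ sym ∷ []) ∷ (ℓ₁≢ℓ₂ ∷ []) ∷ [] ∷ [])
    where
    p₁≁ℓ₂ : ¬ E T p₁ ℓ₂
    p₁≁ℓ₂ = far′ z z≢p₁ p₁≁z
    p₁≢p₂ : p₁ ≢ p₂
    p₁≢p₂ eq = p₁≁ℓ₂ (subst (λ u → E T u ℓ₂) (sym eq) (E-sym T (edge P₂)))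
    ℓ₁≢ℓ₂ : ℓ₁ ≢ ℓ₂
    ℓ₁≢ℓ₂ eq = p₁≁ℓ₂ (subst (E T p₁) eq (E-sym T (edge P₁)))
    p₂≢ℓ₁ : p₂ ≢ ℓ₁
    p₂≢ℓ₁ eq = ℓ₂≢p₁ (only P₁ ℓ₂ (subst (λ u → E T u ℓ₂) eq (E-sym T (edge P₂))))

  -- A switchable pendant is only used to see that v is not adjacent to every other vertex.
  ASPfrom-nonneighbour : ∀ {v} → ASPfrom T v → ∃ λ y → y ≢ v × ¬ E T v y
  ASPfrom-nonneighbour (inj₁ (a , _ , x , x∈ , _ , v≁σx)) = σ a x , proj₂ (pres a x x∈) , v≁σx
  ASPfrom-nonneighbour {v} (inj₂ (c , _ , u , u∈ , a , _ , x , (x∈ , _) , ux , _)) with adj T v u ≟ᵇ true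
  ... | no v≁u = u , proj₂ (Reach-target u∈) , v≁u
  ... | yes vu = x , proj₂ (Reach-target x∈) , λ vx → no-triangle vu vx ux

-- Finite search over copies and colourings

-- Functions are searched through their codes in a finite set. A decoded function agrees with the
-- original only pointwise, hence the condition that `P` respects pointwise equality.
any-function? : ∀ {m k} {P : (Fin m → Fin k) → Set} → (∀ {f g} → (∀ i → f i ≡ g i) → P f → P g) →
                (∀ f → Dec (P f)) → Dec (∃ P)
any-function? resp P? = map′ (λ (i , p) → finToFun i , p)
  (λ (f , p) → funToFin f , resp (sym ∘ finToFun-funToFin f) p) (any? λ i → P? (finToFun i))

injective? : ∀ {m k} (φ : Fin m → Fin k) → Dec (Injective _≡_ _≡_ φ)
injective? φ = map′ (λ h {i} {j} → h i j) (λ h i j → h {i} {j})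
  (all? λ i → all? λ j → (φ i ≟ φ j) →-dec (i ≟ j))

Zero-sum-copy : ∀ {n N} → Graph n → Colouring N → Set
Zero-sum-copy {n} {N} T c = ∃ λ (φ : Fin n → Fin N) → Injective _≡_ _≡_ φ × copySum T φ c % 3 ≡ 0

copySum-cong : ∀ {n N} (T : Graph n) {φ ψ : Fin n → Fin N} {c d : Colouring N} →
               (∀ u w → c (φ u) (φ w) ≡ d (ψ u) (ψ w)) → copySum T φ c ≡ copySum T ψ d
copySum-cong {n} T eq = cong sumᴸ (map-cong (λ u → cong sumᴸ (map-cong (λ w →
  cong (λ a → if (toℕ u <ᵇ toℕ w) ∧ adj T u w then toℕ a else 0) (eq u w)) (allFin n))) (allFin n))

zero-sum-copy? : ∀ {n N} (T : Graph n) (c : Colouring N) → Dec (Zero-sum-copy T c)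
zero-sum-copy? T c = any-function? resp λ φ → injective? φ ×-dec (copySum T φ c % 3 ℕ.≟ 0)
  where
  resp : ∀ {φ ψ} → (∀ i → φ i ≡ ψ i) → Injective _≡_ _≡_ φ × copySum T φ c % 3 ≡ 0 →
         Injective _≡_ _≡_ ψ × copySum T ψ c % 3 ≡ 0
  resp φ≡ψ (inj , eq) =
    (λ {i} {j} h → inj (trans (φ≡ψ i) (trans h (sym (φ≡ψ j))))) ,
    trans (cong (_% 3) (copySum-cong T {c = c} {c} λ u w → sym (cong₂ c (φ≡ψ u) (φ≡ψ w)))) eq

-- Makes the choice between the two candidates for R constructive. Each row of a colouring is coded
-- by a number below `3 ^ N`, so the search runs over functions again.
zeroSumGood? : ∀ {n} (T : Graph n) N → Dec (ZeroSumGood T N)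
zeroSumGood? T N = decide (any-function? {N} {3 ^ N} {λ h → Bad (finToFun ∘ h)}
    (λ eq → bad-resp λ i j → cong (λ a → finToFun a j) (eq i)) (λ h → bad? (finToFun ∘ h)))
  where
  Bad : Colouring N → Set
  Bad c = (∀ i j → c i j ≡ c j i) × ¬ Zero-sum-copy T c
  bad? : ∀ c → Dec (Bad c)
  bad? c = (all? λ i → all? λ j → c i j ≟ c j i) ×-dec ¬? (zero-sum-copy? T c)
  bad-resp : ∀ {c d} → (∀ i j → c i j ≡ d i j) → Bad c → Bad d
  bad-resp {c} {d} eq (c-sym , none) =
    (λ i j → trans (sym (eq i j)) (trans (c-sym i j) (eq j i))) ,
    λ (φ , inj , h) → none (φ , inj , trans (cong (_% 3) (copySum-cong T {φ} {φ} {c} {d} λ u w → eq (φ u) (φ w))) h)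
  decide : Dec (∃ λ (h : Fin N → Fin (3 ^ N)) → Bad (finToFun ∘ h)) → Dec (ZeroSumGood T N)
  decide (yes (h , c-sym , none)) = no λ good → none (good (finToFun ∘ h) c-sym)
  decide (no all-good) = yes λ c c-sym → decidable-stable (zero-sum-copy? T c) λ none →
    all-good (funToFin ∘ c , bad-resp (λ i j → sym (finToFun-funToFin (c i) j)) (c-sym , none))

ZeroSumGood-mono : ∀ {n} (T : Graph n) {N N′} → N ≤ N′ → ZeroSumGood T N → ZeroSumGood T N′
ZeroSumGood-mono T N≤N′ good c c-sym with good (λ i j → c (inject≤ i N≤N′) (inject≤ j N≤N′)) (λ i j → c-sym _ _)
... | φ , φ-inj , eq = (λ u → inject≤ (φ u) N≤N′) , (φ-inj ∘ inject≤-injective N≤N′ N≤N′ _ _) , eq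

ZeroSumGood⇒≤ : ∀ {n} (T : Graph n) {N} → ZeroSumGood T N → n ≤ N
ZeroSumGood⇒≤ T good with good (λ _ _ → 0F) (λ _ _ → refl)
... | φ , φ-inj , _ = injective⇒≤ φ-inj

injective-hits : ∀ {m} {φ : Fin m → Fin m} → Injective _≡_ _≡_ φ → ∀ a → ∃ λ u → φ u ≡ a
injective-hits {suc m} {φ} φ-inj a = decidable-stable (any? λ u → φ u ≟ a) λ miss →
  ℕ.<-irrefl refl (injective⇒≤ {f = λ u → punchOut {i = a} (λ eq → miss (u , sym eq))}
    λ {u} {w} eq → φ-inj (punchOut-injective (λ eq → miss (u , sym eq)) (λ eq → miss (w , sym eq)) eq))

-- Colouring the edges at a with 1 and all others with 0 gives a spanning copy the degree of the vertex placed at a.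
¬ZeroSumGood : ∀ {n} (T : Graph n) → Fin n → (∀ v → deg T v % 3 ≢ 0) → ¬ ZeroSumGood T n
¬ZeroSumGood {n} T a deg≢0 good = refute (good c c-sym)
  where
  open ≡-Reasoning
  open EdgeSums T
  δ : Fin n → Z₃
  δ i = (i == a) ▹ 1F
  c : Colouring n
  c i j = δ i ⊕ δ j
  c-sym : ∀ i j → c i j ≡ c j i
  c-sym i j = ⊕-comm (δ i) (δ j)
  refute : ¬ Zero-sum-copy T c
  refute (φ , φ-inj , eq) = case injective-hits φ-inj a of λ where
      (u , φu≡a) → deg≢0 u (%3≡ (deg T u) 0F (double-injective _ 0F (begin
        double (degree u)
          ≡⟨ cong double (trans (cong (degree u ⊗_) (on φu≡a)) (⊗-comm (degree u) 1F)) ⟨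
        double (degree u ⊗ δ (φ u))
          ≡⟨ cong double (sum-single (λ w → degree w ⊗ δ (φ w)) u (off φu≡a)) ⟨
        double (sum λ w → degree w ⊗ δ (φ w))
          ≡⟨ total-additive (δ ∘ φ) ⟨
        total (λ u w → c (φ u) (φ w))
          ≡⟨ total-copySum φ c c-sym ⟩
        double ⟦ copySum T φ c ⟧
          ≡⟨ cong double (⟦⟧≡ (copySum T φ c) 0F eq) ⟩
        0F ∎)))
    where
    on : ∀ {u} → φ u ≡ a → δ (φ u) ≡ 1F
    on φu≡a rewrite φu≡a | ==-refl a = refl
    off : ∀ {u} → φ u ≡ a → ∀ w → w ≢ u → degree w ⊗ δ (φ w) ≡ 0F
    off φu≡a w h rewrite ==-≢ {u = φ w} {a} (λ eq → h (φ-inj (trans eq (sym φu≡a)))) = ⊗-zeroʳ (degree w)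

ZeroSumGood-suc : ∀ {n} → n % 3 ≡ 1 → 4 ≤ n → (T : Graph n) (connected : Connected T) (acyclic : ¬ HasCycle T) →
                  TwoPendants T connected acyclic → ZeroSumGood T (suc n)
ZeroSumGood-suc {n} n≡1 4≤n T connected acyclic (ℓ₁ , p₁ , ℓ₂ , p₂ , P₁ , P₂ , distinct) c c-sym =
  decidable-stable (zero-sum-copy? T c) λ none →
    Critical.contradictory T connected acyclic (⟦⟧≡ n 1F n≡1) 4≤n P₁ P₂ distinct c c-sym
      λ φ φ-inj eq → none (φ , (λ {i} {j} → φ-inj {i} {j}) , %3≡ (copySum T φ c) 0F
        (double-injective _ 0F (trans (sym (EdgeSums.total-copySum T φ c c-sym)) eq)))

size-cases : ∀ n → n % 3 ≡ 1 → n ≡ 1 ⊎ 4 ≤ n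
size-cases 1 _ = inj₁ refl
size-cases (suc (suc (suc (suc n)))) _ = inj₂ (s≤s (s≤s (s≤s (s≤s z≤n))))

singleton : ∀ (u v : Fin 1) → u ≡ v
singleton fzero fzero = refl

Conclusion : ∀ {n} → Graph n → Set
Conclusion {n} T = ∃ λ m → IsR T m × m ≤ suc n × ((∀ v → deg T v % 3 ≢ 0) → m ≡ suc n)

-- A copy needs `n` vertices, so R is `n` or `suc n`, according to whether `n` vertices already
-- suffice; the degree condition excludes the former.
conclude : ∀ {n} (T : Graph n) → Fin n → 1 ≤ n → ZeroSumGood T (suc n) → Conclusion T
conclude {n} T v 1≤n good with zeroSumGood? T n
... | yes good′ = n , (1≤n , (λ N n≤N → ZeroSumGood-mono T n≤N good′) , λ k _ bound → ZeroSumGood⇒≤ T (bound k ℕ.≤-refl))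
                    , ℕ.n≤1+n n , λ deg≢0 → contradiction good′ (¬ZeroSumGood T v deg≢0)
... | no bad = suc n , (s≤s z≤n , (λ N n<N → ZeroSumGood-mono T n<N good) , λ k _ bound →
                 ℕ.≰⇒> λ k≤n → bad (bound n k≤n))
             , ℕ.≤-refl , λ _ → refl

theorem19 : (n : ℕ) → n % 3 ≡ 1 → (T : Graph n) → IsTree T →
    (∃ λ v → ¬ Leaf T v × ASPfrom T v) →
    ∃ λ m → IsR T m × m ≤ suc n ×
    ((∀ v → deg T v % 3 ≢ 0) → m ≡ suc n)
theorem19 n n≡1 T (connected , acyclic) (v , v-inner , asp) with ASPfrom-nonneighbour T connected acyclic asp | size-cases n n≡1
... | y , y≢v , v≁y | inj₁ refl = contradiction (singleton y v) y≢v
... | y , y≢v , v≁y | inj₂ 4≤n@(s≤s (s≤s _)) = conclude T v (ℕ.≤-trans (s≤s z≤n) 4≤n)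
  (ZeroSumGood-suc n≡1 4≤n T connected acyclic (two-pendants T connected acyclic refl v-inner y≢v v≁y))
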